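{- Let $G$ be a connected graph with $n\geq 3$ vertices. For every two integers $s$ and $r$ with $s\geq 0$ and $r\in\{0,1,2,3\}$, if $\lambda(G)=4s+r$, then $$\lambda_3(G)\geq 3s+\left\lceil\frac{r}{2}\right\rceil.$$ In particular, $\lambda_3(G)\geq \frac{3\lambda(G)-2}{4}$. Moreover, the lower bound is tight: for all integers $s\geq 0$ and $r\in\{0,1,2,3\}$ with $4s+r\geq 1$ there is a connected graph $G$ with $\lambda(G)=4s+r$ and $\lambda_3(G)=3s+\lceil\frac{r}{2}\rceil$.
   Context: All graphs are undirected, finite and simple. $\lambda(G)$ is the edge-connectivity of $G$. For a graph $G$ and a set $S\subseteq V(G)$ of at least two vertices, a tree connecting $S$ is a subgraph $T$ of $G$ that is a tree with $S\subseteq V(T)$. Let $\lambda(S)$ be the maximum number of pairwise edge-disjoint trees connecting $S$ in $G$. The generalized $3$-edge-connectivity of $G$ is $\lambda_3(G)=\min\{\lambda(S) : S\subseteq V(G),\ |S|=3\}$. -}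

module Defs where

open import Data.Nat using (ℕ; zero; suc; z≤n; s≤s; _≤_; _<_; _+_; _∸_; _≤?_)
import Data.Nat.Properties as ℕ
open import Data.Nat.Induction using (<-wellFounded)
open import Induction.WellFounded using (Acc; acc)
open import Data.Fin as Fin using (Fin; zero; suc)
import Data.Fin.Properties as Fin
open import Data.Fin.Subset
  using (Subset; Nonempty; Empty; _∈_; _∉_; _⊆_; _∩_; _∪_; ∁; ⁅_⁆; ⊤; ⊥; ∣_∣; inside)
import Data.Fin.Subset.Properties as Sub
open import Data.List using (List; []; _∷_; _∷ʳ_; length; lookup)
open import Data.List.Relation.Unary.All as All using ([]; _∷_)
open import Data.List.Relation.Unary.AllPairs using ([]; _∷_)
open import Data.List.Relation.Unary.Linked as Linked using (Linked)
open import Data.List.Relation.Unary.Unique.Propositional using (Unique)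
open import Data.List.Relation.Unary.Unique.DecPropositional using (unique?)
open import Data.List.Membership.Propositional.Properties using (∈-lookup)
open import Data.Vec.Base using ([]; _∷_)
open import Data.Product using (Σ; ∃; ∃₂; _×_; _,_; proj₁; proj₂)
open import Data.Sum using (_⊎_; inj₁; inj₂)
open import Function using (_∘_)
open import Relation.Binary.Construct.Closure.ReflexiveTransitive
  using (Star; ε; _◅_; _◅◅_)
open import Relation.Binary.PropositionalEquality
  using (_≡_; _≢_; refl; sym; cong; subst; subst₂)
open import Relation.Nullary using (¬_; Dec; yes; no; contradiction; recompute)
open import Relation.Nullary.Decidable
  using (map′; _×-dec_; _⊎-dec_; _→-dec_; ¬?)

-- The vertex set is Fin n and the edge set is Fin size.  An undirected
-- edge is stored with its smaller end as source, so source<target excludes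
-- loops and distinct excludes parallel edges.

record Graph (n : ℕ) : Set where
  field
    size          : ℕ
    source target : Fin size → Fin n
    source<target : ∀ e → source e Fin.< target e
    distinct      : ∀ {e f} → source e ≡ source f → target e ≡ target f → e ≡ f

open Graph public

module _ {n : ℕ} (G : Graph n) where

  Joins : Fin (size G) → Fin n → Fin n → Set
  Joins e u v = (source G e ≡ u × target G e ≡ v) ⊎ (source G e ≡ v × target G e ≡ u)

  record Subgraph : Set where
    constructor subgraph
    field
      vertices   : Subset n
      edges      : Subset (size G)
      .endpoints : ∀ {e} → e ∈ edges → source G e ∈ vertices × target G e ∈ vertices

open Subgraph public

module _ {n : ℕ} {G : Graph n} where

  endpoints-∈ : (H : Subgraph G) → ∀ {e} → e ∈ edges H →
                source G e ∈ vertices H × target G e ∈ vertices H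
  endpoints-∈ (subgraph V E c) e∈E =
    recompute (_ Sub.∈? V ×-dec _ Sub.∈? V) (c e∈E)

  Adjacent : Subgraph G → Fin n → Fin n → Set
  Adjacent H u v = ∃ λ e → e ∈ edges H × Joins G e u v

  IsConnected : Subgraph G → Set
  IsConnected H = Nonempty (vertices H) ×
    (∀ {u v} → u ∈ vertices H → v ∈ vertices H → Star (Adjacent H) u v)

  record Cycle (H : Subgraph G) : Set where
    field
      start       : Fin n
      rest        : List (Fin n)
      length≥3    : 3 ≤ length (start ∷ rest)
      no-repeats  : Unique (start ∷ rest)
      closed-walk : Linked (Adjacent H) (start ∷ (rest ∷ʳ start))

  IsTree : Subgraph G → Set
  IsTree H = IsConnected H × ¬ Cycle H

  EdgeDisjoint : Subgraph G → Subgraph G → Set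
  EdgeDisjoint H K = Empty (edges H ∩ edges K)

module _ {n : ℕ} (G : Graph n) where

  whole : Subgraph G
  whole = subgraph ⊤ ⊤ (λ _ → Sub.∈⊤ , Sub.∈⊤)

  Connected : Set
  Connected = IsConnected whole

  deleteEdges : Subset (size G) → Subgraph G
  deleteEdges F = subgraph ⊤ (∁ F) (λ _ → Sub.∈⊤ , Sub.∈⊤)

  DisconnectingSize : ℕ → Set
  DisconnectingSize k = ∃ λ F → ¬ IsConnected (deleteEdges F) × ∣ F ∣ ≡ k

  record TreePacking (S : Subset n) (k : ℕ) : Set where
    field
      tree     : Fin k → Subgraph G
      isTree   : ∀ i → IsTree (tree i)
      connects : ∀ i → S ⊆ vertices (tree i)
      disjoint : ∀ {i j} → i ≢ j → EdgeDisjoint (tree i) (tree j)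

record Minimum (P : ℕ → Set) : Set where
  field
    value    : ℕ
    attained : P value
    least    : ∀ {k} → P k → value ≤ k

record Maximum (P : ℕ → Set) : Set where
  field
    value    : ℕ
    attained : P value
    greatest : ∀ {k} → P k → k ≤ value

module _ {P : ℕ → Set} (P? : ∀ k → Dec (P k)) where

  private
    search↑ : ∀ fuel m → P (fuel + m) → (∀ {k} → P k → m ≤ k) → Minimum P
    search↑ zero       m p lb = record { value = m ; attained = p ; least = lb }
    search↑ (suc fuel) m p lb with P? m
    ... | yes pm = record { value = m ; attained = pm ; least = lb }
    ... | no ¬pm = search↑ fuel (suc m) (subst P (sym (ℕ.+-suc fuel m)) p)
      (λ {k} pk → ℕ.≤∧≢⇒< (lb pk) λ m≡k → ¬pm (subst P (sym m≡k) pk))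

  minimum : ∃ P → Minimum P
  minimum (k , pk) = search↑ k 0 (subst P (sym (ℕ.+-identityʳ k)) pk) (λ _ → z≤n)

  maximum : P 0 → ∀ b → (∀ {k} → P k → k ≤ b) → Maximum P
  maximum p₀ zero    ub = record { value = 0 ; attained = p₀ ; greatest = ub }
  maximum p₀ (suc b) ub with P? (suc b)
  ... | yes p = record { value = suc b ; attained = p ; greatest = ub }
  ... | no ¬p = maximum p₀ b
    λ {k} pk → ℕ.≤-pred (ℕ.≤∧≢⇒< (ub pk) λ k≡ → ¬p (subst P k≡ pk))

private
  ∣p∣<∣p∪⁅x⁆∣ : ∀ {n} (p : Subset n) x → x ∉ p → ∣ p ∣ < ∣ p ∪ ⁅ x ⁆ ∣
  ∣p∣<∣p∪⁅x⁆∣ p x x∉p = Sub.p⊂q⇒∣p∣<∣q∣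
    (Sub.p⊆p∪q ⁅ x ⁆ , x , Sub.q⊆p∪q p ⁅ x ⁆ (Sub.x∈⁅x⁆ x) , x∉p)

  ∃∉⇒⊄⊤ : ∀ {n} {p : Subset n} {x} → x ∉ p → ∣ p ∣ < n
  ∃∉⇒⊄⊤ {n} {p} {x} x∉p = subst (∣ p ∣ <_) (Sub.∣⊤∣≡n n)
    (Sub.p⊂q⇒∣p∣<∣q∣ (Sub.⊆⊤ , x , Sub.∈⊤ , x∉p))

  module Reachability {n} {R : Fin n → Fin n → Set} (R? : ∀ x y → Dec (R x y)) (u : Fin n) where

    Closed : Subset n → Set
    Closed X = ∀ {x y} → x ∈ X → R x y → y ∈ X

    saturate : (X : Subset n) → u ∈ X → (∀ {x} → x ∈ X → Star R u x) →
               Acc _<_ (n ∸ ∣ X ∣) →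
               ∃ λ Y → u ∈ Y × (∀ {x} → x ∈ Y → Star R u x) × Closed Y
    saturate X u∈X sound (acc rec)
      with Fin.any? (λ x → Fin.any? (λ y →
             x Sub.∈? X ×-dec R? x y ×-dec ¬? (y Sub.∈? X)))
    ... | yes (x , y , x∈X , xRy , y∉X) =
      saturate (X ∪ ⁅ y ⁆) (Sub.p⊆p∪q ⁅ y ⁆ u∈X) sound′
        (rec (ℕ.∸-monoʳ-< (∣p∣<∣p∪⁅x⁆∣ X y y∉X) (Sub.∣p∣≤n (X ∪ ⁅ y ⁆))))
      where
      sound′ : ∀ {z} → z ∈ X ∪ ⁅ y ⁆ → Star R u z
      sound′ z∈ with Sub.x∈p∪q⁻ X ⁅ y ⁆ z∈
      ... | inj₁ z∈X = sound z∈X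
      ... | inj₂ z∈y rewrite Sub.x∈⁅y⁆⇒x≡y y z∈y = sound x∈X ◅◅ xRy ◅ ε
    ... | no ¬∃ = X , u∈X , sound , closed
      where
      closed : Closed X
      closed {x} {y} x∈X xRy with y Sub.∈? X
      ... | yes y∈X = y∈X
      ... | no  y∉X = contradiction (x , y , x∈X , xRy , y∉X) ¬∃

    star? : ∀ v → Dec (Star R u v)
    star? v with saturate ⁅ u ⁆ (Sub.x∈⁅x⁆ u)
                   (λ x∈ → subst (Star R u) (sym (Sub.x∈⁅y⁆⇒x≡y u x∈)) ε) (<-wellFounded _)
    ... | Y , u∈Y , sound , closed = map′ sound (follow u∈Y) (v Sub.∈? Y)
      where
      follow : ∀ {x y} → x ∈ Y → Star R x y → y ∈ Y
      follow x∈Y ε          = x∈Y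
      follow x∈Y (xRz ◅ r) = follow (closed x∈Y xRz) r

  anyList? : ∀ {n} k {P : List (Fin n) → Set} → (∀ xs → Dec (P xs)) →
             Dec (∃ λ xs → length xs ≤ k × P xs)
  anyList? zero P? = map′ (λ p → [] , z≤n , p) (λ { ([] , _ , p) → p }) (P? [])
  anyList? (suc k) P? = map′
    (λ { (inj₁ p) → [] , z≤n , p ; (inj₂ (x , xs , l , p)) → x ∷ xs , s≤s l , p })
    (λ { ([] , _ , p) → inj₁ p ; (x ∷ xs , s≤s l , p) → inj₂ (x , xs , l , p) })
    (P? [] ⊎-dec Fin.any? (λ x → anyList? k (λ xs → P? (x ∷ xs))))

  unique⇒lookup-injective : ∀ {A : Set} {xs : List A} → Unique xs →
                            ∀ {i j} → lookup xs i ≡ lookup xs j → i ≡ j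
  unique⇒lookup-injective (x∉ ∷ u) {zero}  {zero}  eq = refl
  unique⇒lookup-injective (x∉ ∷ u) {zero}  {suc j} eq = contradiction eq (All.lookup x∉ (∈-lookup j))
  unique⇒lookup-injective (x∉ ∷ u) {suc i} {zero}  eq = sym (unique⇒lookup-injective (x∉ ∷ u) {zero} {suc i} (sym eq))
  unique⇒lookup-injective (x∉ ∷ u) {suc i} {suc j} eq = cong suc (unique⇒lookup-injective u eq)

  unique⇒length≤ : ∀ {n} {xs : List (Fin n)} → Unique xs → length xs ≤ n
  unique⇒length≤ u = Fin.injective⇒≤ (unique⇒lookup-injective u)

module _ {n : ℕ} {G : Graph n} where

  joins? : ∀ e u v → Dec (Joins G e u v)
  joins? e u v = (source G e Fin.≟ u ×-dec target G e Fin.≟ v) ⊎-dec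
                 (source G e Fin.≟ v ×-dec target G e Fin.≟ u)

  adjacent? : (H : Subgraph G) → ∀ u v → Dec (Adjacent H u v)
  adjacent? H u v = Fin.any? (λ e → e Sub.∈? edges H ×-dec joins? e u v)

  isConnected? : (H : Subgraph G) → Dec (IsConnected H)
  isConnected? H = Sub.nonempty? (vertices H) ×-dec
    map′ (λ f {u} {v} → f u v) (λ f u v → f)
      (Fin.all? λ u → Fin.all? λ v →
        u Sub.∈? vertices H →-dec (v Sub.∈? vertices H →-dec
          Reachability.star? (adjacent? H) u v))

  cycle? : (H : Subgraph G) → Dec (Cycle H)
  cycle? H = map′
    (λ { (s , r , _ , l , u , w) → record
         { start = s ; rest = r ; length≥3 = l ; no-repeats = u ; closed-walk = w } })
    (λ c → let open Cycle c in
      start , rest , ℕ.≤-trans (ℕ.n≤1+n _) (unique⇒length≤ no-repeats)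
      , length≥3 , no-repeats , closed-walk)
    (Fin.any? λ s → anyList? n λ r →
      (3 ≤? length (s ∷ r)) ×-dec unique? Fin._≟_ (s ∷ r) ×-dec
      Linked.linked? (adjacent? H) (s ∷ (r ∷ʳ s)))

  isTree? : (H : Subgraph G) → Dec (IsTree H)
  isTree? H = isConnected? H ×-dec ¬? (cycle? H)

  edgeDisjoint? : (H K : Subgraph G) → Dec (EdgeDisjoint H K)
  edgeDisjoint? H K = ¬? (Sub.nonempty? (edges H ∩ edges K))

  private
    anySubgraph? : {P : Subgraph G → Set} → (∀ H → Dec (P H)) → Dec (∃ P)
    anySubgraph? {P} P? = map′
      (λ { (V , E , c , p) → subgraph V E (λ {e} → c e) , p })
      (λ { (H , p) → vertices H , edges H , (λ e → endpoints-∈ H {e}) , p })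
      (Sub.anySubset? λ V → Sub.anySubset? λ E → Σ-dec (closed? V E))
      where
      Closed : Subset n → Subset (size G) → Set
      Closed V E = ∀ e → e ∈ E → source G e ∈ V × target G e ∈ V
      closed? : ∀ V E → Dec (Closed V E)
      closed? V E = Fin.all? λ e → e Sub.∈? E →-dec
        (source G e Sub.∈? V ×-dec target G e Sub.∈? V)
      Σ-dec : ∀ {V E} → Dec (Closed V E) →
              Dec (Σ (Closed V E) λ c → P (subgraph V E (λ {e} → c e)))
      Σ-dec         (no ¬c) = no (¬c ∘ proj₁)
      Σ-dec {V} {E} (yes c) = map′ (c ,_) proj₂ (P? (subgraph V E (λ {e} → c e)))

    anyFamily? : ∀ k {P : (Fin k → Subgraph G) → Set} → (∀ f → Dec (P f)) →
                 (∀ {f g} → (∀ i → f i ≡ g i) → P f → P g) → Dec (∃ P)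
    anyFamily? zero P? resp = map′ (none ,_) (λ { (f , p) → resp (λ ()) p }) (P? none)
      where
      none : Fin 0 → Subgraph G
      none ()
    anyFamily? (suc k) P? resp = map′
      (λ { (H , f , p) → cons H f , p })
      (λ { (f , p) → f zero , f ∘ suc , resp (λ { zero → refl ; (suc i) → refl }) p })
      (anySubgraph? λ H → anyFamily? k (λ f → P? (cons H f))
        (λ eq → resp λ { zero → refl ; (suc i) → eq i }))
      where
      cons : Subgraph G → (Fin k → Subgraph G) → Fin (suc k) → Subgraph G
      cons H f zero    = H
      cons H f (suc i) = f i

  treePacking? : ∀ S k → Dec (TreePacking G S k)
  treePacking? S k = map′
    (λ { (f , t , c , d) → record
         { tree = f ; isTree = t ; connects = c ; disjoint = λ {i} {j} → d i j } })
    (λ p → let open TreePacking p in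
      tree , isTree , (λ i {x} → connects i {x}) , λ i j → disjoint)
    (anyFamily? k
      (λ f → Fin.all? (λ i → isTree? (f i)) ×-dec
             Fin.all? (λ i → S Sub.⊆? vertices (f i)) ×-dec
             Fin.all? (λ i → Fin.all? λ j →
               ¬? (i Fin.≟ j) →-dec edgeDisjoint? (f i) (f j)))
      (λ eq → λ { (t , c , d) →
         (λ i → subst IsTree (eq i) (t i)) ,
         (λ i → subst (λ H → S ⊆ vertices H) (eq i) (c i)) ,
         (λ i j i≢j → subst₂ EdgeDisjoint (eq i) (eq j) (d i j i≢j)) }))

private
  two-elements : ∀ {n} (S : Subset n) → 2 ≤ ∣ S ∣ → ∃₂ λ u v → u ∈ S × v ∈ S × u ≢ v
  two-elements {n} S 2≤ with Sub.nonempty? S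
  ... | no ∅ rewrite Sub.Empty-unique ∅ =
    contradiction (subst (2 ≤_) (Sub.∣⊥∣≡0 n) 2≤) λ ()
  ... | yes (u , u∈) with Fin.any? (λ v → v Sub.∈? S ×-dec ¬? (u Fin.≟ v))
  ...   | yes (v , v∈ , u≢v) = u , v , u∈ , v∈ , u≢v
  ...   | no ¬∃ = contradiction (ℕ.≤-trans 2≤ ∣S∣≤1) λ { (s≤s ()) }
    where
    S⊆ : S ⊆ ⁅ u ⁆
    S⊆ {x} x∈ with u Fin.≟ x
    ... | yes refl = Sub.x∈⁅x⁆ u
    ... | no  u≢x  = contradiction (x , x∈ , u≢x) ¬∃
    ∣S∣≤1 : ∣ S ∣ ≤ 1
    ∣S∣≤1 = subst (∣ S ∣ ≤_) (Sub.∣⁅x⁆∣≡1 u) (Sub.p⊆q⇒∣p∣≤∣q∣ S⊆)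

  subset-of-size : ∀ k n → k ≤ n → ∃ λ (S : Subset n) → ∣ S ∣ ≡ k
  subset-of-size zero    n       z≤n     = ⊥ , Sub.∣⊥∣≡0 n
  subset-of-size (suc k) (suc n) (s≤s l) =
    let S , eq = subset-of-size k n l in inside ∷ S , cong suc eq

  ≡3⇒2≤ : ∀ {m} → m ≡ 3 → 2 ≤ m
  ≡3⇒2≤ refl = s≤s (s≤s z≤n)

module _ {n : ℕ} (G : Graph n) where

  packing-bound : ∀ S → 2 ≤ ∣ S ∣ → ∀ {k} → TreePacking G S k → k ≤ size G
  packing-bound S 2≤ p = Fin.injective⇒≤ {f = proj₁ ∘ edge} injective
    where
    open TreePacking p
    first : ∀ (H : Subgraph G) {u v} → u ≢ v → Star (Adjacent H) u v → Nonempty (edges H)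
    first H u≢v ε                    = contradiction refl u≢v
    first H u≢v ((e , e∈ , _) ◅ _) = e , e∈
    edge : ∀ i → Nonempty (edges (tree i))
    edge i with two-elements S 2≤
    ... | u , v , u∈ , v∈ , u≢v =
      first (tree i) u≢v (proj₂ (proj₁ (isTree i)) (connects i u∈) (connects i v∈))
    injective : ∀ {i j} → proj₁ (edge i) ≡ proj₁ (edge j) → i ≡ j
    injective {i} {j} eq with i Fin.≟ j
    ... | yes i≡j = i≡j
    ... | no  i≢j = contradiction
      (_ , Sub.x∈p∩q⁺ (proj₂ (edge i) , subst (_∈ edges (tree j)) (sym eq) (proj₂ (edge j))))
      (disjoint i≢j)

  deleteAll-disconnects : 2 ≤ n → ¬ IsConnected (deleteEdges G ⊤)
  deleteAll-disconnects (s≤s (s≤s _)) (_ , conn)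
    with conn {zero} {suc zero} Sub.∈⊤ Sub.∈⊤
  ... | (e , e∈ , _) ◅ _ = Sub.x∈∁p⇒x∉p e∈ Sub.∈⊤

  opaque
    minimumDisconnectingSize : .(2 ≤ n) → Minimum (DisconnectingSize G)
    minimumDisconnectingSize 2≤n = minimum
      (λ k → Sub.anySubset? λ F → ¬? (isConnected? (deleteEdges G F)) ×-dec (∣ F ∣ ℕ.≟ k))
      (∣ ⊤ {n = size G} ∣ , ⊤ , deleteAll-disconnects (recompute (2 ≤? n) 2≤n) , refl)

    maximumTreePacking : ∀ S → .(2 ≤ ∣ S ∣) → Maximum (TreePacking G S)
    maximumTreePacking S 2≤ = maximum (treePacking? S)
      record { tree = λ () ; isTree = λ () ; connects = λ () ; disjoint = λ { {()} } }
      (size G) (packing-bound S (recompute (2 ≤? ∣ S ∣) 2≤))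

  -- λ(G) for a graph with at least two vertices
  edgeConnectivity : .(2 ≤ n) → ℕ
  edgeConnectivity 2≤n = Minimum.value (minimumDisconnectingSize 2≤n)

  -- λ(S) for a set of at least two vertices
  treeConnectivity : ∀ S → .(2 ≤ ∣ S ∣) → ℕ
  treeConnectivity S 2≤∣S∣ = Maximum.value (maximumTreePacking S 2≤∣S∣)

  TripleConnectivity : ℕ → Set
  TripleConnectivity k =
    ∃ λ S → Σ (∣ S ∣ ≡ 3) λ ∣S∣≡3 → treeConnectivity S (≡3⇒2≤ ∣S∣≡3) ≡ k

  opaque
    minimumTripleConnectivity : .(3 ≤ n) → Minimum TripleConnectivity
    minimumTripleConnectivity 3≤n = minimum
      (λ k → Sub.anySubset? λ S → Σ-dec S k (∣ S ∣ ℕ.≟ 3))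
      (let S , eq = subset-of-size 3 n (recompute (3 ≤? n) 3≤n) in _ , S , eq , refl)
      where
      Σ-dec : ∀ S k → Dec (∣ S ∣ ≡ 3) →
              Dec (Σ (∣ S ∣ ≡ 3) λ eq → treeConnectivity S (≡3⇒2≤ eq) ≡ k)
      Σ-dec S k (no ¬eq) = no (¬eq ∘ proj₁)
      Σ-dec S k (yes eq) = map′ (eq ,_) proj₂ (treeConnectivity S (≡3⇒2≤ eq) ℕ.≟ k)

  -- λ₃(G) for a graph with at least three vertices
  λ₃ : .(3 ≤ n) → ℕ
  λ₃ 3≤n = Minimum.value (minimumTripleConnectivity 3≤n)

{-# OPTIONS --safe #-}
module Submission where

-- Lower bound.  Let every cut isolating one of the terminals a, b, c have at least ℓ edges, in
-- a multigraph.  Delete an edge while this remains true.  If a tight set X isolating, say, a has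
-- an inner edge, contract X to a; a packing of the contraction lifts, because by Menger's theorem
-- the ℓ edges leaving X continue inside X along edge-disjoint paths to a.  If neither is possible,
-- every edge ends in a terminal of degree ℓ, and {a, v} is not tight for a neighbour v of a.  So
-- a nonterminal v with an edge has edges to all three terminals: these form one tree, whose
-- removal costs 1 in tight cuts and at most 2 in the others, so ℓ drops by 1.  In the end all
-- edges join terminals, and trees are pairs of edges, taken greedily at the terminal of largest
-- degree.
--
-- Tightness.  Join three large cliques pairwise by matchings of sizes A, B, B with A + B = ℓ and
-- B - A ≤ 1.  A tree meeting all three cliques uses two of the A + 2B matching edges.

open import Defs
open import Data.Nat using (ℕ; _+_; _*_; _≤_; _≥_; ⌈_/2⌉)
open import Data.Nat.Properties using (<⇒≤)
import Data.Integer as ℤ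
open import Data.Rational as ℚ using ()
open import Data.Product using (Σ; ∃; _×_)
open import Relation.Binary.PropositionalEquality using (_≡_)

open import Algebra.Properties.CommutativeMonoid.Sum Data.Nat.Properties.+-0-commutativeMonoid
  using (sum; ∑-distrib-+; sum-cong-≗)
open import Data.Bool using (Bool; true; false; not; _∧_; _∨_; _xor_; if_then_else_)
import Data.Bool.Properties as Bool
open import Data.Fin as Fin using (Fin; zero; suc)
import Data.Fin.Properties as Fin
open import Data.Fin.Subset
  using (Subset; _∈_; _∉_; _⊆_; _∪_; ⁅_⁆; ⊥; ∣_∣; inside; outside; _-_)
import Data.Fin.Subset.Properties as Sub
import Data.Integer.Properties as ℤ
open import Data.List using ([]; _∷_; _∷ʳ_)
import Data.List.Relation.Unary.All as ListAll
import Data.List.Relation.Unary.AllPairs as ListAllPairs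
open import Data.List.Relation.Unary.Linked as Linked using (Linked)
open import Data.Nat using (zero; suc; z≤n; s≤s; _<_; ⌊_/2⌋)
open import Data.Nat.DivMod using (_/_; _%_; m%n<n; m≡m%n+[m/n]*n)
import Data.Nat.Properties as ℕ
open import Data.Nat.Solver using (module +-*-Solver)
open import Data.Product using (∃₂; _,_; proj₁; proj₂)
import Data.Rational.Properties as ℚ
open import Data.Rational.Unnormalised using (mkℚᵘ; *≤*)
import Data.Rational.Unnormalised.Properties as ℚᵘ
open import Data.Sum using (_⊎_; inj₁; inj₂; [_,_])
open import Data.Vec as Vec using (tabulate; lookup)
open import Data.Vec.Functional using (updateAt)
open import Data.Vec.Functional.Properties using (updateAt-updates; updateAt-minimal)
open import Data.Vec.Properties using (lookup∘tabulate; []=⇒lookup; lookup⇒[]=)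
import Data.Vec.Relation.Unary.All as All
import Data.Vec.Relation.Unary.AllPairs as AllPairs
open import Data.Vec.Relation.Unary.Unique.Propositional.Properties using (lookup-injective)
open import Function using (_∘_; id; const)
open import Relation.Binary.Construct.Closure.ReflexiveTransitive as Star using (Star; ε; _◅_; _◅◅_)
open import Relation.Binary.Definitions using (tri<; tri≈; tri>)
open import Relation.Binary.PropositionalEquality
  using (_≢_; _≗_; refl; sym; trans; cong; cong₂; subst; subst₂; module ≡-Reasoning)
open import Relation.Nullary using (¬_; Dec; yes; no; does; contradiction)
open import Relation.Nullary.Decidable
  using (map′; _×-dec_; _⊎-dec_; _→-dec_; ¬?; dec-true; dec-false; decidable-stable)

-- Contraction destroys simplicity, hence the passage to multigraphs. Trees are handled as colour
-- classes of edges that need only connect the terminals; they are cut down to trees at the very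
-- end, so that no step has to preserve acyclicity. Contraction cannot spoil the cut condition,
-- because the cuts of the contraction are the cuts of `G` that do not split `X`. Tightness of `X`
-- is what lets Menger's theorem give one path for each edge leaving `X`: every set between the
-- terminal and `X` isolates the same terminal, so none has a smaller cut. The constant comes from
-- the final stage: three degrees of at least ℓ add up to 3ℓ or more, and a tree of two edges takes
-- four from this total. When all edges join terminals the total is even, which is why 4k ≤ 3ℓ + 1
-- is enough.

sum-mono-≤ : ∀ {m} {f g : Fin m → ℕ} → (∀ e → f e ≤ g e) → sum f ≤ sum g
sum-mono-≤ {zero}  f≤g = z≤n
sum-mono-≤ {suc m} f≤g = ℕ.+-mono-≤ (f≤g zero) (sum-mono-≤ (f≤g ∘ suc))

-- The two inequalities leave no room at any index. For 0/1 terms: an inclusion of edge sets of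
-- equal size is an equality, which is how tight cuts are exploited.
sum-antimono : ∀ {m} {f g : Fin m → ℕ} → (∀ e → f e ≤ g e) → sum g ≤ sum f → ∀ e → g e ≤ f e
sum-antimono {suc m} {f} {g} f≤g Σg≤Σf zero =
  ℕ.+-cancelʳ-≤ (sum (g ∘ suc)) _ _
    (ℕ.≤-trans Σg≤Σf (ℕ.+-monoʳ-≤ (f zero) (sum-mono-≤ (f≤g ∘ suc))))
sum-antimono {suc m} {f} {g} f≤g Σg≤Σf (suc e) =
  sum-antimono (f≤g ∘ suc)
    (ℕ.+-cancelˡ-≤ (g zero) _ _ (ℕ.≤-trans Σg≤Σf (ℕ.+-monoˡ-≤ _ (f≤g zero)))) e

-- Edges are found by counting: when one cut, or a sum of two cuts, exceeds another, some edge
-- contributes more to the larger side.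
sum-<⇒∃< : ∀ {m} (f g : Fin m → ℕ) → sum f < sum g → ∃ λ e → f e < g e
sum-<⇒∃< f g Σf<Σg with Fin.any? (λ e → f e ℕ.<? g e)
... | yes found = found
... | no  ¬∃    = contradiction (sum-mono-≤ λ e → ℕ.≮⇒≥ (λ lt → ¬∃ (e , lt))) (ℕ.<⇒≱ Σf<Σg)

sum-update : ∀ {m} {f g : Fin m → ℕ} e → g e ≡ 0 → (∀ e′ → e′ ≢ e → f e′ ≡ g e′) →
             sum f ≡ f e + sum g
sum-update {suc m} {f} {g} zero g≡0 eq =
  cong (f zero +_) (trans (sum-cong-≗ λ e → eq (suc e) λ ()) (cong (_+ sum (g ∘ suc)) (sym g≡0)))
sum-update {suc m} {f} {g} (suc e) g≡0 eq = begin
  f zero + sum (f ∘ suc)                 ≡⟨ cong₂ _+_ (eq zero λ ())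
    (sum-update e g≡0 λ e′ e′≢ → eq (suc e′) (e′≢ ∘ Fin.suc-injective)) ⟩
  g zero + (f (suc e) + sum (g ∘ suc))   ≡⟨ ℕ.+-assoc (g zero) _ _ ⟨
  g zero + f (suc e) + sum (g ∘ suc)     ≡⟨ cong (_+ sum (g ∘ suc)) (ℕ.+-comm (g zero) _) ⟩
  f (suc e) + g zero + sum (g ∘ suc)     ≡⟨ ℕ.+-assoc (f (suc e)) _ _ ⟩
  f (suc e) + (g zero + sum (g ∘ suc))   ∎
  where open ≡-Reasoning

𝟙 : Bool → ℕ
𝟙 true  = 1
𝟙 false = 0

𝟙≤1 : ∀ b → 𝟙 b ≤ 1
𝟙≤1 true  = s≤s z≤n
𝟙≤1 false = z≤n

𝟙-mono : ∀ {b c} → (b ≡ true → c ≡ true) → 𝟙 b ≤ 𝟙 c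
𝟙-mono {false} _ = z≤n
𝟙-mono {true} b⇒c rewrite b⇒c refl = s≤s z≤n

𝟙-mono⁻ : ∀ {b c} → 𝟙 b ≤ 𝟙 c → b ≡ true → c ≡ true
𝟙-mono⁻ {true} {true} _ _ = refl

sum-𝟙-< : ∀ {m} {p q : Fin m → Bool} {e} → (∀ e → p e ≡ true → q e ≡ true) →
          p e ≡ false → q e ≡ true → sum (𝟙 ∘ p) < sum (𝟙 ∘ q)
sum-𝟙-< {p = p} {q} {e} p⇒q pe qe = ℕ.≰⇒> λ Σq≤Σp →
  contradiction (trans (sym pe) (𝟙-mono⁻ {q e} (sum-antimono (λ e → 𝟙-mono (p⇒q e)) Σq≤Σp e) qe))
    λ ()

does⁻ : ∀ {P : Set} (P? : Dec P) → does P? ≡ true → P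
does⁻ (yes p) _ = p

-- Cuts in multigraphs

VertexSet : ℕ → Set
VertexSet n = Fin n → Bool

anyVertexSet? : ∀ {n} {P : VertexSet n → Set} → (∀ X → Dec (P X)) →
                (∀ {X Y} → X ≗ Y → P X → P Y) → Dec (∃ P)
anyVertexSet? P? resp = map′
  (λ { (X , p) → lookup X , p })
  (λ { (X , p) → tabulate X , resp (λ v → sym (lookup∘tabulate X v)) p })
  (Sub.anySubset? (P? ∘ lookup))

-- Parallel edges and loops are allowed.  Loops never cross a cut, so an edge is
-- deleted by turning it into a loop and the edge set stays Fin m throughout.
Multigraph : ℕ → ℕ → Set
Multigraph m n = Fin m → Fin n × Fin n

module Multi {m n : ℕ} where

  src tgt : Multigraph m n → Fin m → Fin n
  src G e = proj₁ (G e)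
  tgt G e = proj₂ (G e)

  cross inner : Multigraph m n → VertexSet n → Fin m → Bool
  cross G X e = X (src G e) xor X (tgt G e)
  inner G X e = X (src G e) ∧ X (tgt G e)

  cut : Multigraph m n → VertexSet n → ℕ
  cut G X = sum (𝟙 ∘ cross G X)

  NonLoop : Multigraph m n → Fin m → Set
  NonLoop G e = src G e ≢ tgt G e

  nonLoop? : ∀ G e → Dec (NonLoop G e)
  nonLoop? G e = ¬? (src G e Fin.≟ tgt G e)

  delete : Multigraph m n → Fin m → Multigraph m n
  delete G e = updateAt G e (λ (u , _) → u , u)

  collapse : VertexSet n → Fin n → Fin n → Fin n
  collapse X a v = if X v then a else v

  contract : Multigraph m n → VertexSet n → Fin n → Multigraph m n
  contract G X a e = collapse X a (src G e) , collapse X a (tgt G e)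

  data Joined (G : Multigraph m n) (e : Fin m) (u v : Fin n) : Set where
    fwd : G e ≡ (u , v) → Joined G e u v
    bwd : G e ≡ (v , u) → Joined G e u v

  -- The colour type is left open because two kinds of colouring occur: by numbers of trees in a
  -- packing, and by edges in a fan, where the colour of a path edge is the leaving edge that the
  -- path serves.
  record Link {C : Set} (G : Multigraph m n) (col : Fin m → C) (c : C) (u v : Fin n) : Set where
    constructor via
    field
      edge     : Fin m
      coloured : col edge ≡ c
      joined   : Joined G edge u v

  Conn : {C : Set} → Multigraph m n → (Fin m → C) → C → Fin n → Fin n → Set
  Conn G col c = Star (Link G col c)

  joined-src-tgt : ∀ G e → Joined G e (src G e) (tgt G e)
  joined-src-tgt G e = fwd refl

  joined-sym : ∀ {G e u v} → Joined G e u v → Joined G e v u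
  joined-sym (fwd eq) = bwd eq
  joined-sym (bwd eq) = fwd eq

  joined⇒cross : ∀ {G e u v} X → Joined G e u v → cross G X e ≡ X u xor X v
  joined⇒cross             X (fwd eq) rewrite eq = refl
  joined⇒cross {u = u} {v} X (bwd eq) rewrite eq = Bool.xor-comm (X v) (X u)

  joined⇒inner : ∀ {G e u v} X → Joined G e u v → inner G X e ≡ X u ∧ X v
  joined⇒inner             X (fwd eq) rewrite eq = refl
  joined⇒inner {u = u} {v} X (bwd eq) rewrite eq = Bool.∧-comm (X v) (X u)

  joined⇒nonLoop : ∀ {G e u v} → Joined G e u v → u ≢ v → NonLoop G e
  joined⇒nonLoop (fwd eq) u≢v rewrite eq = u≢v
  joined⇒nonLoop (bwd eq) u≢v rewrite eq = u≢v ∘ sym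

  joined-≢ : ∀ {G e u v} → Joined G e u v → NonLoop G e → u ≢ v
  joined-≢ (fwd eq) nl rewrite eq = nl
  joined-≢ (bwd eq) nl rewrite eq = nl ∘ sym

  joined-unique : ∀ {G e u v w} → Joined G e u v → Joined G e u w → v ≡ w
  joined-unique (fwd p) (fwd q) = cong proj₂ (trans (sym p) q)
  joined-unique (bwd p) (bwd q) = cong proj₁ (trans (sym p) q)
  joined-unique (fwd p) (bwd q) with refl ← trans (sym p) q = refl
  joined-unique (bwd p) (fwd q) with refl ← trans (sym p) q = refl

  cross⇒nonLoop : ∀ G X {e} → cross G X e ≡ true → NonLoop G e
  cross⇒nonLoop G X {e} c s≡t rewrite s≡t = contradiction
    (trans (sym (Bool.xor-same (X (tgt G e)))) c) λ ()

  cross⇒¬inner : ∀ G X {e} → cross G X e ≡ true → inner G X e ≡ false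
  cross⇒¬inner G X {e} c with X (src G e) | X (tgt G e)
  ... | true  | false = refl
  ... | false | _     = refl

  inner⇒¬cross : ∀ G X {e} → inner G X e ≡ true → cross G X e ≡ false
  inner⇒¬cross G X {e} i with X (src G e) | X (tgt G e)
  ... | true | true = refl

  delete-other : ∀ {G e e′} → e′ ≢ e → delete G e e′ ≡ G e′
  delete-other {G} {e} {e′} e′≢e = updateAt-minimal e′ e G e′≢e

  delete-self : ∀ G e → src (delete G e) e ≡ tgt (delete G e) e
  delete-self G e rewrite updateAt-updates e {λ (u , _) → u , u} G = refl

  delete-joined : ∀ {G e e′ u v} → e′ ≢ e → Joined G e′ u v → Joined (delete G e) e′ u v
  delete-joined e′≢e (fwd eq) = fwd (trans (delete-other e′≢e) eq)
  delete-joined e′≢e (bwd eq) = bwd (trans (delete-other e′≢e) eq)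

  delete-nonLoop : ∀ {G e e′} → NonLoop (delete G e) e′ → e′ ≢ e × NonLoop G e′
  delete-nonLoop {G} {e} {e′} nl = e′≢e , subst (λ p → proj₁ p ≢ proj₂ p) (delete-other e′≢e) nl
    where
    e′≢e : e′ ≢ e
    e′≢e refl = nl (delete-self G e)

  delete-cross : ∀ {G e e′} X → e′ ≢ e → cross G X e′ ≡ cross (delete G e) X e′
  delete-cross X e′≢e = cong (λ (u , v) → X u xor X v) (sym (delete-other e′≢e))

  cut-delete : ∀ G X e → cut G X ≡ 𝟙 (cross G X e) + cut (delete G e) X
  cut-delete G X e = sum-update e
    (cong 𝟙 (loop (delete-self G e)))
    (λ e′ e′≢e → cong 𝟙 (delete-cross X e′≢e))
    where
    loop : ∀ {u v} → u ≡ v → X u xor X v ≡ false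
    loop {u} refl = Bool.xor-same (X u)

  cut-cong : ∀ G {X Y} → X ≗ Y → cut G X ≡ cut G Y
  cut-cong G X≗Y = sum-cong-≗ λ e → cong 𝟙 (cong₂ _xor_ (X≗Y (src G e)) (X≗Y (tgt G e)))

  conn-sym : ∀ {C : Set} {G : Multigraph m n} {col : Fin m → C} {c u v} → Conn G col c u v →
      Conn G col c v u
  conn-sym = Star.reverse λ (via e ce j) → via e ce (joined-sym j)

  link : ∀ {C : Set} {G : Multigraph m n} {col : Fin m → C} {c e u v} → col e ≡ c → Joined G e u v →
      Conn G col c u v
  link ce j = via _ ce j ◅ ε

  -- Deletion, recolouring and contraction all lift paths in this one way: each edge of `G′` is
  -- replaced by a path of its own colour in `G`, which is empty where the edge has become a loop.
  conn-lift : ∀ {C : Set} {G G′ : Multigraph m n} {col col′ : Fin m → C} →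
              (∀ e → Conn G col (col′ e) (src G′ e) (tgt G′ e)) →
              ∀ {c u v} → Conn G′ col′ c u v → Conn G col c u v
  conn-lift {G = G} {G′} {col} {col′} lift {c} = step Star.⋆
    where
    step : ∀ {u v} → Link G′ col′ c u v → Conn G col c u v
    step (via e refl (fwd eq)) = subst (λ (u , v) → Conn G col _ u v) eq (lift e)
    step (via e refl (bwd eq)) = conn-sym (subst (λ (u , v) → Conn G col _ u v) eq (lift e))

  conn-delete : ∀ {C : Set} {G : Multigraph m n} {e} {col col′ : Fin m → C} →
      (∀ {e′} → e′ ≢ e → col e′ ≡ col′ e′) →
                ∀ {c u v} → Conn (delete G e) col′ c u v → Conn G col c u v
  conn-delete {G = G} {e} {col} {col′} same = conn-lift lift
    where
    lift : ∀ e′ → Conn G col (col′ e′) (src (delete G e) e′) (tgt (delete G e) e′)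
    lift e′ with e′ Fin.≟ e
    ... | yes refl = subst (Conn G col (col′ e) _) (delete-self G e) ε
    ... | no e′≢e rewrite delete-other {G} e′≢e = link (same e′≢e) (joined-src-tgt G e′)

  recolour : {C : Set} → (Fin m → C) → Fin m → C → Fin m → C
  recolour col e c = updateAt col e (const c)

  -- The colour given to `e` is free: in `delete G e` this edge is a loop, so no old path depends on
  -- it.
  conn-recolour : ∀ {C : Set} {G : Multigraph m n} {e} {col : Fin m → C} {c′} →
                  ∀ {c u v} → Conn (delete G e) col c u v → Conn G (recolour col e c′) c u v
  conn-recolour {e = e} {col} = conn-delete λ {e′} e′≢e → updateAt-minimal e′ e col e′≢e

  link-recolour : ∀ {C : Set} {G : Multigraph m n} {e u v} {col : Fin m → C} {c} →
                  Joined G e u v → Conn G (recolour col e c) c u v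
  link-recolour {e = e} {col = col} = link (updateAt-updates e col)

  singleton : Fin n → VertexSet n
  singleton u v = does (u Fin.≟ v)

  _⊑_ : VertexSet n → VertexSet n → Set
  Y ⊑ X = ∀ v → Y v ≡ true → X v ≡ true

  singleton-self : ∀ u → singleton u u ≡ true
  singleton-self u = dec-true (u Fin.≟ u) refl

  singleton-other : ∀ {u v} → u ≢ v → singleton u v ≡ false
  singleton-other {u} {v} u≢v = dec-false (u Fin.≟ v) u≢v

  singleton⁻ : ∀ {u v} → singleton u v ≡ true → u ≡ v
  singleton⁻ {u} {v} eq with yes u≡v ← u Fin.≟ v = u≡v

  cross-singleton⁻ : ∀ {G u e} → cross G (singleton u) e ≡ true →
                     ∃ λ v → Joined G e u v
  cross-singleton⁻ {G} {u} {e} c with u Fin.≟ src G e | u Fin.≟ tgt G e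
  ... | yes u≡s | no _     = tgt G e , fwd (cong (_, tgt G e) (sym u≡s))
  ... | no _    | yes u≡t  = src G e , bwd (cong (src G e ,_) (sym u≡t))

  cross-singleton⁺ : ∀ {G u v e} → Joined G e u v → u ≢ v → cross G (singleton u) e ≡ true
  cross-singleton⁺ {G} {u} {v} j u≢v = begin
    cross G (singleton u) _           ≡⟨ joined⇒cross (singleton u) j ⟩
    singleton u u xor singleton u v   ≡⟨ cong₂ _xor_ (singleton-self u) (singleton-other u≢v) ⟩
    true                              ∎
    where open ≡-Reasoning

  _∪ₛ_ : VertexSet n → VertexSet n → VertexSet n
  (X ∪ₛ Y) v = X v ∨ Y v

  -- The ends of `e` cannot both be `u`, for then both would lie in the pair. So neither is `u`, and
  -- the crossing happens at `v`.
  cross-pair : ∀ {G u v e} → cross G (singleton u ∪ₛ singleton v) e ≡ true →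
               cross G (singleton u) e ≡ false → ∃ λ w → Joined G e v w × w ≢ u
  cross-pair {G} {u} {v} {e} c ¬c =
    let w , j = cross-singleton⁻ crossᵥ in
    w , j , λ w≡u → let j′ = subst (Joined G e v) w≡u j in contradiction
      (trans (sym ¬c) (cross-singleton⁺ (joined-sym j′)
        (joined-≢ j′ (cross⇒nonLoop G (singleton v) crossᵥ) ∘ sym))) λ ()
    where
    split : ∀ {p q p′ q′} → (p ∨ q) xor (p′ ∨ q′) ≡ true → p xor p′ ≡ false → q xor q′ ≡ true
    split {true}  {p′ = true}  () _
    split {true}  {p′ = false} _ ()
    split {false} {p′ = true}  _ ()
    split {false} {p′ = false} c _ = c
    crossᵥ : cross G (singleton v) e ≡ true
    crossᵥ = split {singleton u (src G e)} {singleton v (src G e)} c ¬c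

  record InnerEdge (G : Multigraph m n) (X : VertexSet n) (e : Fin m) : Set where
    constructor innerEdge
    field
      nonLoop : NonLoop G e
      both  : inner G X e ≡ true

  open InnerEdge

  innerEdge? : ∀ G X e → Dec (InnerEdge G X e)
  innerEdge? G X e = map′ (λ (nl , i) → innerEdge nl i) (λ b → nonLoop b , both b)
    (nonLoop? G e ×-dec inner G X e Bool.≟ true)

  -- The termination measure. Loops do not count, so an edge that is deleted or contracted to a
  -- point disappears from it; for the full vertex set it counts all non-loops.
  innerSize : Multigraph m n → VertexSet n → ℕ
  innerSize G X = sum λ e → 𝟙 (does (innerEdge? G X e))

  innerSize-< : ∀ {G G′ X X′ e} → (∀ {e} → InnerEdge G X e → InnerEdge G′ X′ e) →
      ¬ InnerEdge G X e → InnerEdge G′ X′ e →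
           innerSize G X < innerSize G′ X′
  innerSize-< {G} {G′} {X} {X′} {e} imp ¬b b =
    sum-𝟙-< (λ e eq → dec-true (innerEdge? G′ X′ e) (imp (does⁻ (innerEdge? G X e) eq)))
            (dec-false (innerEdge? G X e) ¬b) (dec-true (innerEdge? G′ X′ e) b)

  delete-innerEdge : ∀ {G X e e′} → InnerEdge (delete G e) X e′ → e′ ≢ e × InnerEdge G X e′
  delete-innerEdge {G} {X} (innerEdge nl i) = let e′≢e , nl′ = delete-nonLoop nl in
    e′≢e , innerEdge nl′ (trans (cong (λ (u , v) → X u ∧ X v) (sym (delete-other {G} e′≢e))) i)

  delete-inner : ∀ {G e e′} X → e′ ≢ e → inner G X e′ ≡ inner (delete G e) X e′
  delete-inner X e′≢e = cong (λ (u , v) → X u ∧ X v) (sym (delete-other e′≢e))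

  module _ {G X a} (Xa : X a ≡ true) (bare : ∀ {e} → ¬ InnerEdge G X e) where

    private
      star≤ : ∀ e → 𝟙 (cross G (singleton a) e) ≤ 𝟙 (cross G X e)
      star≤ e with cross G (singleton a) e in c
      ... | false = z≤n
      ... | true with cross-singleton⁻ {G} c
      ...   | v , j with X v in Xv
      ...     | true  = contradiction
                          (innerEdge (cross⇒nonLoop G (singleton a) c)
                            (trans (joined⇒inner {G} X j) (cong₂ _∧_ Xa Xv)))
                          bare
      ...     | false = ℕ.≤-reflexive (cong 𝟙
        (sym (trans (joined⇒cross {G} X j) (cong₂ _xor_ Xa Xv))))

    -- As `X` has no inner edge, every non-loop edge at `a` leaves `X`.
    bare⇒cut≥star : cut G (singleton a) ≤ cut G X
    bare⇒cut≥star = sum-mono-≤ star≤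

    -- The edges at `a` are among those leaving `X`; equal size turns the inclusion into an
    -- equality.
    bare⇒cross-star : cut G X ≤ cut G (singleton a) →
                      ∀ {e} → cross G X e ≡ true → cross G (singleton a) e ≡ true
    bare⇒cross-star le {e} = 𝟙-mono⁻ {cross G X e} (sum-antimono star≤ le e)

  -- One deletion lowers a cut by at most one. A cut that falls below `k` therefore contained `e`
  -- and had exactly `k` edges: it was tight.
  delete-drops-cut : ∀ {G X e k} → cut (delete G e) X < k → k ≤ cut G X → cross G X e ≡ true ×
      cut G X ≤ k
  delete-drops-cut {G} {X} {e} lt k≤ with cross G X e | cut-delete G X e
  ... | true  | eq = refl , subst (_≤ _) (sym eq) lt
  ... | false | eq = contradiction (ℕ.≤-trans (ℕ.≤-trans lt k≤) (ℕ.≤-reflexive eq))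
    (ℕ.<-irrefl refl)

  -- Menger's theorem

  -- For every edge f leaving X, the colour class of f connects a to f inside X; edges not
  -- inside X own themselves.
  record Fan (G : Multigraph m n) (X : VertexSet n) (a : Fin n) (owner : Fin m → Fin m) : Set where
    field
      outer : ∀ {e} → inner G X e ≡ false → owner e ≡ e
      spoke : ∀ {f} → cross G X f ≡ true → Conn G owner f a (src G f)

    own : ∀ {f} → cross G X f ≡ true → owner f ≡ f
    own c = outer (cross⇒¬inner G X c)

    spoke′ : ∀ {f} → cross G X f ≡ true → Conn G owner f a (tgt G f)
    spoke′ {f} c = spoke c ◅◅ link (own c) (joined-src-tgt G f)

  conn-map : ∀ {C D : Set} {G : Multigraph m n} {col : Fin m → C} (h : C → D) {c u v} →
             Conn G col c u v → Conn G (h ∘ col) (h c) u v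
  conn-map h = Star.map λ (via e ce j) → via e (cong h ce) j

  -- Re-expanding a contracted set: an edge leaving X brings along its path to a.
  conn-contract : ∀ {C : Set} {G : Multigraph m n} {X a owner} → Fan G X a owner →
      {col : Fin m → C} →
                  ∀ {c u v} → Conn (contract G X a) col c u v → Conn G (col ∘ owner) c u v
  conn-contract {G = G} {X} {a} {owner} fan {col} = conn-lift lift
    where
    open Fan fan
    lift : ∀ e → Conn G (col ∘ owner) (col e) (collapse X a (src G e)) (collapse X a (tgt G e))
    lift e with X (src G e) in Xs | X (tgt G e) in Xt
    ... | true  | true  = ε
    ... | true  | false = conn-map col (spoke′ (cong₂ _xor_ Xs Xt))
    ... | false | true  = conn-sym (conn-map col (spoke (cong₂ _xor_ Xs Xt)))
    ... | false | false = link (cong col (outer (cong₂ _∧_ Xs Xt))) (joined-src-tgt G e)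

  LeastCut : Multigraph m n → VertexSet n → Fin n → Set
  LeastCut G X a = ∀ Y → Y a ≡ true → Y ⊑ X → cut G X ≤ cut G Y

  module _ {X Y : VertexSet n} {a} (Xa : X a ≡ true) (Y⊑X : Y ⊑ X) where

    collapse-⊑ : X ∘ collapse Y a ≗ X
    collapse-⊑ v with Y v in Yv
    ... | true  = trans Xa (sym (Y⊑X v Yv))
    ... | false = refl

    contract-inner : ∀ G e → inner (contract G Y a) X e ≡ inner G X e
    contract-inner G e = cong₂ _∧_ (collapse-⊑ (src G e)) (collapse-⊑ (tgt G e))

    contract-cross : ∀ G e → cross (contract G Y a) X e ≡ cross G X e
    contract-cross G e = cong₂ _xor_ (collapse-⊑ (src G e)) (collapse-⊑ (tgt G e))

  contract-nonLoop : ∀ {G X a e} → NonLoop (contract G X a) e → NonLoop G e × inner G X e ≡ false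
  contract-nonLoop {G} {X} {a} {e} nl = nl ∘ cong (collapse X a) , ¬inner
    where
    ¬inner : inner G X e ≡ false
    ¬inner with X (src G e) | X (tgt G e)
    ... | true  | true  = contradiction refl nl
    ... | true  | false = refl
    ... | false | _     = refl

  -- A path edge inside `Y` is owned by an edge leaving `Y`, and that edge in turn by an edge
  -- leaving `X`; hence the composite `o₂ ∘ o₁`. Paths of the contraction are re-expanded by
  -- `conn-contract`.
  fan-compose : ∀ {G X Y a o₁ o₂} → X a ≡ true → Y ⊑ X →
                Fan G Y a o₁ → Fan (contract G Y a) X a o₂ → Fan G X a (o₂ ∘ o₁)
  fan-compose {G} {X} {Y} {a} {o₁} {o₂} Xa Y⊑X fan₁ fan₂ = record { outer = outer ; spoke = spoke }
    where
    inner-mono : ∀ {e} → inner G X e ≡ false → inner G Y e ≡ false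
    inner-mono {e} i with Y (src G e) in Ys | Y (tgt G e) in Yt
    ... | true  | true  = contradiction (trans (sym i) (cong₂ _∧_ (Y⊑X _ Ys) (Y⊑X _ Yt))) λ ()
    ... | true  | false = refl
    ... | false | _     = refl
    outer : ∀ {e} → inner G X e ≡ false → o₂ (o₁ e) ≡ e
    outer {e} i = trans (cong o₂ (Fan.outer fan₁ (inner-mono i)))
      (Fan.outer fan₂ (trans (contract-inner Xa Y⊑X G e) i))
    spoke : ∀ {f} → cross G X f ≡ true → Conn G (o₂ ∘ o₁) f a (src G f)
    spoke {f} c = go (conn-contract fan₁ (Fan.spoke fan₂ c′))
      where
      c′ : cross (contract G Y a) X f ≡ true
      c′ = trans (contract-cross Xa Y⊑X G f) c
      go : Conn G (o₂ ∘ o₁) f a (collapse Y a (src G f)) → Conn G (o₂ ∘ o₁) f a (src G f)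
      go path with Y (src G f) in Ys
      ... | false = path
      -- The path in the contraction only reaches `a`, while `f` starts inside `Y`. Since `f` leaves
      -- `X`, it also leaves `Y`, and its spoke in the first fan reaches it.
      ... | true  = subst (λ h → Conn G (o₂ ∘ o₁) h a (src G f)) (Fan.own fan₂ c′)
        (conn-map o₂ (Fan.spoke fan₁ (cong₂ _xor_ Ys Yt)))
        where
        Yt : Y (tgt G f) ≡ false
        Yt with Y (tgt G f) in Yt
        ... | false = refl
        ... | true  = contradiction (trans (sym c) (cong₂ _xor_ (Y⊑X _ Ys) (Y⊑X _ Yt))) λ ()

  fan-delete : ∀ {G X a e o} → inner G X e ≡ true → Fan (delete G e) X a o → Fan G X a o
  fan-delete {G} {X} {a} {e} {o} i fan = record { outer = outer ; spoke = spoke }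
    where
    outer : ∀ {e′} → inner G X e′ ≡ false → o e′ ≡ e′
    outer {e′} i′ = Fan.outer fan (trans (sym (delete-inner X e′≢e)) i′)
      where
      e′≢e : e′ ≢ e
      e′≢e refl = contradiction (trans (sym i) i′) λ ()
    spoke : ∀ {f} → cross G X f ≡ true → Conn G o f a (src G f)
    spoke {f} c = conn-delete (λ _ → refl)
      (subst (Conn (delete G e) o f a ∘ proj₁) (delete-other f≢e)
        (Fan.spoke fan (trans (sym (delete-cross X f≢e)) c)))
      where
      f≢e : f ≢ e
      f≢e refl = contradiction (trans (sym (inner⇒¬cross G X i)) c) λ ()

  -- The new spoke is a, v, w in the colour `f`; all other spokes live in the graph without `e` and
  -- `f`. Recolouring `f` by itself matters: after deletion it is a loop that may lie inside `X`,
  -- where `o` is unconstrained.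
  fan-extend : ∀ {G X a e f v w o} → e ≢ f → Joined G e a v → Joined G f v w →
               X a ≡ true → X v ≡ true → X w ≡ false →
               Fan (delete (delete G e) f) X a o → Fan G X a (recolour (recolour o f f) e f)
  fan-extend {G} {X} {a} {e} {f} {v} {w} {o} e≢f je jf Xa Xv Xw fan =
    record { outer = outer ; spoke = spoke }
    where
    o′ : Fin m → Fin m
    o′ = recolour (recolour o f f) e f
    o′f≡f : o′ f ≡ f
    o′f≡f = trans (updateAt-minimal f e (recolour o f f) (e≢f ∘ sym)) (updateAt-updates f o)
    i : inner G X e ≡ true
    i = trans (joined⇒inner X je) (cong₂ _∧_ Xa Xv)
    outer : ∀ {e′} → inner G X e′ ≡ false → o′ e′ ≡ e′
    outer {e′} i′ with e′ Fin.≟ f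
    ... | yes refl = o′f≡f
    ... | no e′≢f  = trans (updateAt-minimal e′ e (recolour o f f) e′≢e)
      (trans (updateAt-minimal e′ f o e′≢f)
      (Fan.outer fan (trans (sym (trans (delete-inner X e′≢e) (delete-inner X e′≢f))) i′)))
      where
      e′≢e : e′ ≢ e
      e′≢e refl = contradiction (trans (sym i) i′) λ ()
    spoke : ∀ {g} → cross G X g ≡ true → Conn G o′ g a (src G g)
    spoke {g} c with g Fin.≟ f
    ... | yes refl = link (updateAt-updates e (recolour o f f)) je ◅◅ rest jf
      where
      rest : Joined G f v w → Conn G o′ f v (src G f)
      rest (fwd eq) = subst (Conn G o′ f v) (sym (cong proj₁ eq)) ε
      rest (bwd eq) = subst (Conn G o′ f v) (sym (cong proj₁ eq)) (link o′f≡f jf)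
    ... | no g≢f = conn-recolour (conn-recolour
        (subst (Conn (delete (delete G e) f) o g a ∘ proj₁)
          (trans (delete-other g≢f) (delete-other g≢e))
          (Fan.spoke fan (trans (sym (trans (delete-cross X g≢e) (delete-cross X g≢f))) c))))
      where
      g≢e : g ≢ e
      g≢e refl = contradiction (trans (sym (inner⇒¬cross G X i)) c) λ ()

  _⊑?_ : ∀ (Y X : VertexSet n) → Dec (Y ⊑ X)
  Y ⊑? X = Fin.all? λ v → (Y v Bool.≟ true) →-dec (X v Bool.≟ true)

  -- Induction on the number of inner edges, with `N` a strict bound. An inner edge is deleted if
  -- `X` stays a least cut; otherwise a tight set obstructs, which either splits the problem in two
  -- or has the same leaving edges as `a`. The paths are edge-disjoint because an edge has only one
  -- owner.
  menger : ∀ N (G : Multigraph m n) X a → innerSize G X < N → X a ≡ true → LeastCut G X a →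
      ∃ (Fan G X a)
  menger (suc N) G X a (s≤s innerSize≤N) Xa least = choose
    where
    AtCentre : Fin m → Set
    AtCentre e = cross G (singleton a) e ≡ true

    fewer : ∀ {G′ X′ e} → (∀ {e} → InnerEdge G′ X′ e → InnerEdge G X e) → ¬ InnerEdge G′ X′ e →
        InnerEdge G X e → innerSize G′ X′ < N
    fewer imp ¬b b = ℕ.<-≤-trans (innerSize-< imp ¬b b) innerSize≤N

    via-delete : ∀ {e} → InnerEdge G X e → LeastCut (delete G e) X a → ∃ (Fan G X a)
    via-delete {e} busy least′ =
      let o , fan = menger N (delete G e) X a
                      (fewer (proj₂ ∘ delete-innerEdge)
                        (λ b → proj₁ (delete-innerEdge b) refl) busy) Xa least′
      in o , fan-delete (both busy) fan

    -- Both recursive calls have fewer inner edges: `e` is inside `X` but not inside `Y`, and `e′`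
    -- becomes a loop when `Y` is contracted.
    via-contract : ∀ {Y e e′} → Y a ≡ true → Y ⊑ X → cut G Y ≤ cut G X →
                   InnerEdge G X e → ¬ InnerEdge G Y e → InnerEdge G Y e′ → ∃ (Fan G X a)
    via-contract {Y} {e} {e′} Ya Y⊑X Y≤X busy ¬busy busy′ =
      let o₁ , fan₁ = menger N G Y a (fewer up ¬busy busy) Ya
                        λ Z Za Z⊑Y → ℕ.≤-trans Y≤X (least Z Za λ v → Y⊑X v ∘ Z⊑Y v)
          o₂ , fan₂ = menger N (contract G Y a) X a (fewer down ¬busy′ (up busy′)) Xa least′
      in o₂ ∘ o₁ , fan-compose Xa Y⊑X fan₁ fan₂
      where
      up : ∀ {e} → InnerEdge G Y e → InnerEdge G X e
      up (innerEdge nl i) = innerEdge nl (∧-mono i)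
        where
        ∧-mono : ∀ {u v} → Y u ∧ Y v ≡ true → X u ∧ X v ≡ true
        ∧-mono {u} {v} i with Y u in Yu | Y v in Yv
        ... | true | true = cong₂ _∧_ (Y⊑X u Yu) (Y⊑X v Yv)
      down : ∀ {e} → InnerEdge (contract G Y a) X e → InnerEdge G X e
      down {e} (innerEdge nl i) = innerEdge (proj₁ (contract-nonLoop {G} {Y} nl))
        (trans (sym (contract-inner Xa Y⊑X G e)) i)
      ¬busy′ : ¬ InnerEdge (contract G Y a) X e′
      ¬busy′ (innerEdge nl _) = contradiction
        (trans (sym (both busy′)) (proj₂ (contract-nonLoop {G} {Y} nl))) λ ()
      least′ : LeastCut (contract G Y a) X a
      -- The cut of `Z` in the contraction is by computation the cut of `Z ∘ collapse Y a` in `G`, a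
      -- set that still contains `a` and lies in `X`.
      least′ Z Za Z⊑X = begin
        cut G (X ∘ collapse Y a)  ≡⟨ cut-cong G (collapse-⊑ Xa Y⊑X) ⟩
        cut G X                   ≤⟨ least (Z ∘ collapse Y a) Z∘a Z∘⊑X ⟩
        cut G (Z ∘ collapse Y a)  ∎
        where
        open ℕ.≤-Reasoning
        Z∘a : Z (collapse Y a a) ≡ true
        Z∘a rewrite Ya = Za
        Z∘⊑X : (Z ∘ collapse Y a) ⊑ X
        Z∘⊑X v eq with Y v in Yv
        ... | true  = Y⊑X v Yv
        ... | false = Z⊑X v eq

    -- All inner edges are at a, and δ(a) is a least cut: an edge a–v is continued by
    -- an edge from v out of X, and every cut in question loses exactly one of the two.
    via-path : ∀ {e} → (∀ {e} → InnerEdge G X e → AtCentre e) → InnerEdge G X e →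
               cut G (singleton a) ≤ cut G X → ∃ (Fan G X a)
    via-path {e} allAtA busy a≤X = extract (cross-singleton⁻ (allAtA busy))
      where
      extract : (∃ λ v → Joined G e a v) → ∃ (Fan G X a)
      extract (v , je) = continue (Fin.any? λ f → (cross G pair f Bool.≟ true) ×-dec
        (cross G (singleton a) f Bool.≟ false))
        where
        pair : VertexSet n
        pair = singleton a ∪ₛ singleton v
        a≢v : a ≢ v
        a≢v = joined-≢ je (nonLoop busy)
        Xv : X v ≡ true
        Xv with X v | trans (sym (joined⇒inner {G = G} X je)) (both busy)
        ... | true  | _ = refl
        ... | false | eq = trans (sym (Bool.∧-zeroʳ (X a))) eq
        pair-a : pair a ≡ true
        pair-a rewrite singleton-self a = refl
        pair-v : pair v ≡ true
        pair-v rewrite singleton-self v = Bool.∨-zeroʳ (singleton a v)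
        pair⊑X : pair ⊑ X
        pair⊑X w eq with a Fin.≟ w | v Fin.≟ w
        ... | yes refl | _        = Xa
        ... | no _     | yes refl = Xv
        continue : Dec (∃ λ f → cross G pair f ≡ true × cross G (singleton a) f ≡ false) →
            ∃ (Fan G X a)
        -- Without such an `f`, the edges leaving {a, v} would all leave `a` and would not include
        -- `e`: a cut smaller than that of `a`, hence smaller than the least cut.
        continue (no ¬∃) = contradiction
          (sum-𝟙-< imp (trans (joined⇒cross pair je) (cong₂ _xor_ pair-a pair-v))
            (cross-singleton⁺ je a≢v))
          (ℕ.≤⇒≯ (ℕ.≤-trans a≤X (least pair pair-a pair⊑X)))
          where
          imp : ∀ f → cross G pair f ≡ true → cross G (singleton a) f ≡ true
          imp f c with cross G (singleton a) f in ¬c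
          ... | true  = refl
          ... | false = contradiction (f , c , ¬c) ¬∃
        continue (yes (f , c , ¬c)) = leave (cross-pair c ¬c)
          where
          e≢f : e ≢ f
          e≢f refl = contradiction (trans (sym (allAtA busy)) ¬c) λ ()
          G″ : Multigraph m n
          G″ = delete (delete G e) f
          leave : (∃ λ w → Joined G f v w × w ≢ a) → ∃ (Fan G X a)
          leave (w , jf , w≢a) =
            let o , fan = menger N G″ X a (fewer
                  (proj₂ ∘ delete-innerEdge ∘ proj₂ ∘ delete-innerEdge)
                            (λ b → proj₁ (delete-innerEdge
                              (proj₂ (delete-innerEdge b))) refl) busy) Xa least″
            in _ , fan-extend e≢f je jf Xa Xv Xw fan
            where
            Xw : X w ≡ false
            Xw with X w in Xw
            ... | false = refl
            ... | true  = contradiction (trans (sym ¬c) (allAtA (innerEdge (cross⇒nonLoop G pair c)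
                            (trans (joined⇒inner X jf) (cong₂ _∧_ Xv Xw))))) λ ()
            drop : ∀ Z → Z a ≡ true → Z ⊑ X → cut G Z ≡ suc (cut G″ Z)
            drop Z Za Z⊑X = begin
              cut G Z
                ≡⟨ cut-delete G Z e ⟩
              𝟙 (cross G Z e) + cut (delete G e) Z
                ≡⟨ cong₂ _+_ (cong 𝟙 crossₑ) (cut-delete (delete G e) Z f) ⟩
              𝟙 (not (Z v)) + (𝟙 (cross (delete G e) Z f) + cut G″ Z)
                ≡⟨ cong (λ b → 𝟙 (not (Z v)) + (𝟙 b + cut G″ Z)) cross-f ⟩
              𝟙 (not (Z v)) + (𝟙 (Z v) + cut G″ Z)                                         ≡⟨ one
                (Z v) ⟩
              suc (cut G″ Z)                                                               ∎
              where
              open ≡-Reasoning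
              Zw : Z w ≡ false
              Zw with Z w in Zw
              ... | false = refl
              ... | true  = contradiction (trans (sym Xw) (Z⊑X w Zw)) λ ()
              crossₑ : cross G Z e ≡ not (Z v)
              crossₑ = trans (joined⇒cross Z je) (cong (_xor Z v) Za)
              cross-f : cross (delete G e) Z f ≡ Z v
              cross-f = trans (sym (delete-cross Z (e≢f ∘ sym))) (trans (joined⇒cross Z jf)
                (trans (cong (Z v xor_) Zw) (Bool.xor-identityʳ (Z v))))
              one : ∀ b {k} → 𝟙 (not b) + (𝟙 b + k) ≡ suc k
              one true  = refl
              one false = refl
            least″ : LeastCut G″ X a
            least″ Z Za Z⊑X = ℕ.≤-pred (subst₂ _≤_ (drop X Xa λ _ → id) (drop Z Za Z⊑X)
              (least Z Za Z⊑X))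

    -- A bare tight `Y` is crossed only by edges at `a`, so an inner edge `e` away from `a` never
    -- leads to the path case. That case is left for when all inner edges are at `a`, which the
    -- second argument supplies.
    reduce : ∀ {e} → InnerEdge G X e → (AtCentre e → ∀ {e} → InnerEdge G X e → AtCentre e) →
        ∃ (Fan G X a)
    reduce {e} busy atA with anyVertexSet? {P = λ Y → Y a ≡ true × Y ⊑ X × cut
      (delete G e) Y < cut G X}
        (λ Y → (Y a Bool.≟ true) ×-dec (Y ⊑? X) ×-dec (cut (delete G e) Y ℕ.<? cut G X))
        (λ {Y} {Z} Y≗Z (Ya , Y⊑X , lt) → trans (sym (Y≗Z a)) Ya ,
          (λ v Zv → Y⊑X v (trans (Y≗Z v) Zv)) ,
          subst (_< cut G X) (cut-cong (delete G e) Y≗Z) lt)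
    ... | no ¬∃ = via-delete busy λ Y Ya Y⊑X → ℕ.≤-trans
          (ℕ.≤-reflexive (sym (trans (cut-delete G X e)
            (cong (λ b → 𝟙 b + cut (delete G e) X) (inner⇒¬cross G X (both busy))))))
          (ℕ.≮⇒≥ λ lt → ¬∃ (Y , Ya , Y⊑X , lt))
    ... | yes (Y , Ya , Y⊑X , lt) with delete-drops-cut {G} {Y} lt (least Y Ya Y⊑X) | Fin.any?
      (innerEdge? G Y)
    ...   | c , Y≤X | yes (e′ , busy′) = via-contract Ya Y⊑X Y≤X busy
            (λ b → contradiction (trans (sym (both b)) (cross⇒¬inner G Y c)) λ ()) busy′
    ...   | c , Y≤X | no bare = via-path (atA atCentre) busy
      (ℕ.≤-trans (bare⇒cut≥star Ya (λ b → bare (_ , b))) Y≤X)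
            where
            atCentre : AtCentre e
            atCentre = bare⇒cross-star Ya (λ b → bare (_ , b))
              (ℕ.≤-trans Y≤X (least (singleton a) (singleton-self a)
              λ v eq → subst (λ w → X w ≡ true) (singleton⁻ eq) Xa)) c

    choose : ∃ (Fan G X a)
    choose with Fin.any? (λ e → innerEdge? G X e ×-dec ¬? (cross G (singleton a) e Bool.≟ true))
    ... | yes (e , busy , ¬c) = reduce busy λ c → contradiction c ¬c
    ... | no ¬∃ with Fin.any? (innerEdge? G X)
    ...   | yes (e , busy) = reduce busy λ _ {e} busy → decidable-stable (_ Bool.≟ true) λ ¬c → ¬∃
      (e , busy , ¬c)
    -- With no inner edges, the edges leaving the least cut `X` are those at `a`, so every spoke is
    -- empty or a single edge.
    ...   | no bare = id , record { outer = λ _ → refl ; spoke = spoke }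
            where
            spoke : ∀ {f} → cross G X f ≡ true → Conn G id f a (src G f)
            spoke {f} c with cross-singleton⁻ {G = G} (bare⇒cross-star Xa (λ b → bare (_ , b))
              (least (singleton a) (singleton-self a) λ v eq → subst (λ w → X w ≡ true)
                (singleton⁻ eq) Xa) c)
            ... | v , fwd eq = subst (Conn G id f a) (sym (cong proj₁ eq)) ε
            ... | v , bwd eq = subst (Conn G id f a) (sym (cong proj₁ eq)) (link refl (bwd eq))

𝟙-< : ∀ {b c} → 𝟙 b < 𝟙 c → b ≡ false × c ≡ true
𝟙-< {false} {true}  _ = refl , refl
𝟙-< {true}  {true}  (s≤s ())

opaque
  other-two : ∀ {i j k : Fin 3} → i ≢ j → i ≢ k → j ≢ k → ∀ l → l ≡ i ⊎ l ≡ j ⊎ l ≡ k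
  other-two {i} {j} {k} i≢j i≢k j≢k l with i Fin.≟ l | j Fin.≟ l | k Fin.≟ l
  ... | yes i≡l | _       | _       = inj₁ (sym i≡l)
  ... | no _    | yes j≡l | _       = inj₂ (inj₁ (sym j≡l))
  ... | no _    | no _    | yes k≡l = inj₂ (inj₂ (sym k≡l))
  ... | no i≢l  | no j≢l  | no k≢l  = contradiction
    (Fin.injective⇒≤ {f = lookup (i Vec.∷ j Vec.∷ k Vec.∷ l Vec.∷ Vec.[])}
      (lookup-injective ((i≢j All.∷ i≢k All.∷ i≢l All.∷ All.[]) AllPairs.∷
        (j≢k All.∷ j≢l All.∷ All.[]) AllPairs.∷
                         (k≢l All.∷ All.[]) AllPairs.∷ All.[] AllPairs.∷ AllPairs.[]) _ _))
    λ { (s≤s (s≤s (s≤s ()))) }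

-- Packing trees on three terminals

swap-last : ∀ a b c → a + b + c ≡ a + c + b
swap-last = solve 3 (λ a b c → a :+ b :+ c := a :+ c :+ b) refl
  where open +-*-Solver

rotate : ∀ a b c → a + b + c ≡ b + c + a
rotate = solve 3 (λ a b c → a :+ b :+ c := b :+ c :+ a) refl
  where open +-*-Solver

-- A tree of two edges takes four from the total degree: one at each outer terminal and two at the
-- middle one.
total-drop : ∀ {k a b c} → 4 * suc k ≤ suc (suc a + suc b + suc (suc c)) → 4 * k ≤ suc (a + b + c)
total-drop {k} {a} {b} {c} le = ℕ.+-cancelʳ-≤ 4 _ _ (subst₂ _≤_
  (solve 1 (λ k → con 4 :* (con 1 :+ k) := con 4 :* k :+ con 4) refl k)
  (solve 3 (λ a b c → con 1 :+ ((con 1 :+ a) :+ (con 1 :+ b) :+ (con 2 :+ c)) := con 1 :+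
    (a :+ b :+ c) :+ con 4) refl a b c)
  le)
  where open +-*-Solver

-- If `d < k`, the largest degree `c` is at most `k + 1`, and so are the others; then 4(k + 1) ≤ 3(k
-- + 1) + 1 makes `k` zero, against `d < k`. So the middle terminal can afford to lose two.
maximum-large : ∀ {k a b c d} → c ≡ suc (suc d) → a ≤ c → b ≤ c → 4 * suc k ≤ suc (a + b + c) →
    k ≤ d
maximum-large {k} {a} {b} {c} {d} c≡ a≤c b≤c le = ℕ.≮⇒≥ λ d<k → ℕ.<⇒≱ d<k
  (ℕ.≤-trans (k≤0 (c≤ d<k)) z≤n)
  where
  open +-*-Solver
  open ℕ.≤-Reasoning
  c≤ : d < k → c ≤ suc k
  c≤ d<k = subst (_≤ suc k) (sym c≡) (s≤s d<k)
  k≤0 : c ≤ suc k → k ≤ 0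
  k≤0 c≤ = ℕ.+-cancelʳ-≤ (3 * k + 4) k 0 (begin
    k + (3 * k + 4)              ≡⟨ solve 1 (λ k → k :+ (con 3 :* k :+ con 4) := con 4 :*
      (con 1 :+ k)) refl k ⟩
    4 * suc k                    ≤⟨ le ⟩
    suc (a + b + c)              ≤⟨ s≤s (ℕ.+-mono-≤
      (ℕ.+-mono-≤ (ℕ.≤-trans a≤c c≤) (ℕ.≤-trans b≤c c≤)) c≤) ⟩
    suc (suc k + suc k + suc k)  ≡⟨ solve 1 (λ k → con 1 :+
      ((con 1 :+ k) :+ (con 1 :+ k) :+ (con 1 :+ k)) := con 3 :* k :+ con 4) refl k ⟩
    3 * k + 4                    ∎)

module Packings {m n : ℕ} (τ : Fin 3 → Fin n) (τ-injective : ∀ {i j} → τ i ≡ τ j → i ≡ j) where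
  open Multi {m} {n}

  star : Fin 3 → VertexSet n
  star i = singleton (τ i)

  star-τ : ∀ i j → star i (τ j) ≡ does (i Fin.≟ j)
  star-τ i j with i Fin.≟ j
  ... | yes refl = singleton-self (τ i)
  ... | no i≢j   = singleton-other (i≢j ∘ τ-injective)

  degree : Multigraph m n → Fin 3 → ℕ
  degree G i = cut G (star i)

  record Packing (G : Multigraph m n) (k : ℕ) : Set where
    field
      colour    : Fin m → ℕ
      connected : ∀ {c} → c < k → ∀ i j → Conn G colour c (τ i) (τ j)

  open Packing

  no-packing : ∀ {G} → Packing G 0
  no-packing = record { colour = const 0 ; connected = λ () }

  through : ∀ {G : Multigraph m n} {col : Fin m → ℕ} {c h} → (∀ i → Conn G col c (τ i) h) → ∀ i j →
      Conn G col c (τ i) (τ j)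
  through toHub i j = toHub i ◅◅ conn-sym (toHub j)

  OnlyTerminals : Multigraph m n → Set
  OnlyTerminals G = ∀ {e u v} → Joined G e u v → u ≢ v → ∃ λ i → u ≡ τ i

  -- Edges from `τ k` to either of the others count equally in `degree G k` and in
  -- `degree G i + degree G j`. As all edges join terminals, the excess comes from an edge between
  -- `τ i` and `τ j`.
  pick : ∀ {G i j k} → OnlyTerminals G → i ≢ j → i ≢ k → j ≢ k →
      degree G k < degree G i + degree G j →
         ∃ λ e → Joined G e (τ i) (τ j)
  pick {G} {i} {j} {k} only i≢j i≢k j≢k lt = found (sum-<⇒∃< (𝟙 ∘ cross G (star k))
      (λ e → 𝟙 (cross G (star i) e) + 𝟙 (cross G (star j) e))
      (subst (degree G k <_) (sym (∑-distrib-+ (𝟙 ∘ cross G (star i)) (𝟙 ∘ cross G (star j)))) lt))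
    where
    meets : ∀ {i j e} → i ≢ j → i ≢ k → j ≢ k →
            𝟙 (cross G (star k) e) < 𝟙 (cross G (star i) e) + 𝟙 (cross G (star j) e) →
            cross G (star i) e ≡ true → Joined G e (τ i) (τ j)
    meets {i} {j} {e} i≢j i≢k j≢k lt c with cross-singleton⁻ c
    ... | w , jw with only (joined-sym jw) (joined-≢ jw (cross⇒nonLoop G (star i) c) ∘ sym)
    ...   | q , refl with other-two i≢j i≢k j≢k q
    ...     | inj₁ refl = contradiction refl (joined-≢ jw (cross⇒nonLoop G (star i) c))
    ...     | inj₂ (inj₁ refl) = jw
    ...     | inj₂ (inj₂ refl) = contradiction lt (ℕ.≤⇒≯ (ℕ.≤-reflexive (begin
      𝟙 (cross G (star i) e) + 𝟙 (cross G (star j) e)  ≡⟨ cong₂ (λ b b′ → 𝟙 b + 𝟙 b′) c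
        (trans (joined⇒cross (star j) jw)
           (cong₂ _xor_ (singleton-other (i≢j ∘ sym ∘ τ-injective))
             (singleton-other (j≢k ∘ τ-injective)))) ⟩
      1                                                ≡⟨ cong 𝟙
        (cross-singleton⁺ (joined-sym jw) (i≢k ∘ sym ∘ τ-injective)) ⟨
      𝟙 (cross G (star k) e)                           ∎)))
      where open ≡-Reasoning
    found : (∃ λ e → 𝟙 (cross G (star k) e) < 𝟙 (cross G (star i) e) + 𝟙 (cross G (star j) e)) →
            ∃ λ e → Joined G e (τ i) (τ j)
    found (e , lt) with cross G (star i) e in ci | cross G (star j) e in cj
    ... | true  | _     = e , meets i≢j i≢k j≢k
      (subst₂ (λ b b′ → 𝟙 (cross G (star k) e) < 𝟙 b + 𝟙 b′) (sym ci) (sym cj) lt) ci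
    ... | false | true  = e , joined-sym (meets (i≢j ∘ sym) j≢k i≢k
            (subst₂ (λ b b′ → 𝟙 (cross G (star k) e) < 𝟙 b + 𝟙 b′) (sym cj) (sym ci) lt) cj)

  total : Multigraph m n → ℕ
  total G = degree G zero + degree G (suc zero) + degree G (suc (suc zero))

  -- Of the three terminals, l has the largest degree; a pair of edges from it to
  -- the other two becomes one tree.
  pack-terminals : ∀ k G → OnlyTerminals G → (∀ i → k ≤ degree G i) → 4 * k ≤ suc (total G) →
      Packing G k
  pack-terminals zero    G only k≤ 4k≤ = no-packing
  pack-terminals (suc k) G only k≤ 4k≤ = largest
    where
    step : ∀ {i j l} → i ≢ j → i ≢ l → j ≢ l →
        (∀ (d : Fin 3 → ℕ) → d zero + d (suc zero) + d (suc (suc zero)) ≡ d i + d j + d l) →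
           degree G i ≤ degree G l → degree G j ≤ degree G l → Packing G (suc k)
    step {i} {j} {l} i≢j i≢l j≢l sum≡ i≤l j≤l = pair
      (pick only i≢l i≢j (j≢l ∘ sym) (ℕ.≤-trans (s≤s (ℕ.m≤n+m _ k)) (ℕ.+-mono-≤ (k≤ i) j≤l)))
      (pick only j≢l (i≢j ∘ sym) (i≢l ∘ sym) (ℕ.≤-trans (s≤s (ℕ.m≤n+m _ k))
        (ℕ.+-mono-≤ (k≤ j) i≤l)))
      where
      pair : (∃ λ e → Joined G e (τ i) (τ l)) → (∃ λ f → Joined G f (τ j) (τ l)) → Packing G (suc k)
      pair (e , je) (f , jf) = add rest
        where
        f≢e : f ≢ e
        f≢e f≡e = i≢j (τ-injective (joined-unique (joined-sym je)
          (subst (λ g → Joined G g (τ l) (τ j)) f≡e (joined-sym jf))))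
        G″ : Multigraph m n
        G″ = delete (delete G e) f
        deg : ∀ p → degree G p ≡ 𝟙 (does (p Fin.≟ i) xor does (p Fin.≟ l)) +
            (𝟙 (does (p Fin.≟ j) xor does (p Fin.≟ l)) + degree G″ p)
        deg p = trans (cut-delete G (star p) e) (cong₂ _+_
          (cong 𝟙 (trans (joined⇒cross (star p) je) (cong₂ _xor_ (star-τ p i) (star-τ p l))))
          (trans (cut-delete (delete G e) (star p) f) (cong (λ b → 𝟙 b + degree G″ p)
            (trans (sym (delete-cross (star p) f≢e))
              (trans (joined⇒cross (star p) jf) (cong₂ _xor_ (star-τ p j) (star-τ p l)))))))
        deg-i : degree G i ≡ suc (degree G″ i)
        deg-i = trans (deg i) (cong₂ (λ b b′ → 𝟙 b + (𝟙 b′ + degree G″ i))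
          (cong₂ _xor_ (dec-true (i Fin.≟ i) refl) (dec-false (i Fin.≟ l) i≢l))
          (cong₂ _xor_ (dec-false (i Fin.≟ j) i≢j) (dec-false (i Fin.≟ l) i≢l)))
        deg-j : degree G j ≡ suc (degree G″ j)
        deg-j = trans (deg j) (cong₂ (λ b b′ → 𝟙 b + (𝟙 b′ + degree G″ j))
          (cong₂ _xor_ (dec-false (j Fin.≟ i) (i≢j ∘ sym)) (dec-false (j Fin.≟ l) j≢l))
          (cong₂ _xor_ (dec-true (j Fin.≟ j) refl) (dec-false (j Fin.≟ l) j≢l)))
        deg-l : degree G l ≡ suc (suc (degree G″ l))
        deg-l = trans (deg l) (cong₂ (λ b b′ → 𝟙 b + (𝟙 b′ + degree G″ l))
          (cong₂ _xor_ (dec-false (l Fin.≟ i) (i≢l ∘ sym)) (dec-true (l Fin.≟ l) refl))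
          (cong₂ _xor_ (dec-false (l Fin.≟ j) (j≢l ∘ sym)) (dec-true (l Fin.≟ l) refl)))
        only″ : OnlyTerminals G″
        only″ jo u≢v = let nl = delete-nonLoop (joined⇒nonLoop jo u≢v) in
          only (undelete jo (nl .proj₁) (delete-nonLoop (nl .proj₂) .proj₁)) u≢v
          where
          undelete : ∀ {e′ u v} → Joined G″ e′ u v → e′ ≢ f → e′ ≢ e → Joined G e′ u v
          undelete (fwd eq) ≢f ≢e = fwd (trans (sym (trans (delete-other ≢f) (delete-other ≢e))) eq)
          undelete (bwd eq) ≢f ≢e = bwd (trans (sym (trans (delete-other ≢f) (delete-other ≢e))) eq)
        4k≤ijl : 4 * suc k ≤ suc (degree G i + degree G j + degree G l)
        4k≤ijl = subst (λ t → 4 * suc k ≤ suc t) (sum≡ (degree G)) 4k≤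
        largest-enough : k ≤ degree G″ l
        largest-enough =
          maximum-large {k} {degree G i} {degree G j} {degree G l} {degree G″ l} deg-l i≤l j≤l
          4k≤ijl
        k≤″ : ∀ p → k ≤ degree G″ p
        k≤″ p with other-two i≢j i≢l j≢l p
        ... | inj₁ refl        = ℕ.≤-pred (subst (suc k ≤_) deg-i (k≤ i))
        ... | inj₂ (inj₁ refl) = ℕ.≤-pred (subst (suc k ≤_) deg-j (k≤ j))
        ... | inj₂ (inj₂ refl) = largest-enough
        4k≤″ : 4 * k ≤ suc (total G″)
        4k≤″ = subst (λ t → 4 * k ≤ suc t) (sym (sum≡ (degree G″)))
          (total-drop {k} {degree G″ i} {degree G″ j} {degree G″ l}
            (subst (λ t → 4 * suc k ≤ suc t) (cong₂ _+_ (cong₂ _+_ deg-i deg-j) deg-l) 4k≤ijl))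
        rest : Packing G″ k
        rest = pack-terminals k G″ only″ k≤″ 4k≤″
        add : Packing G″ k → Packing G (suc k)
        add base = record { colour = col ; connected = conn }
          where
          col : Fin m → ℕ
          col = recolour (recolour (colour base) f k) e k
          conn : ∀ {c} → c < suc k → ∀ p q → Conn G col c (τ p) (τ q)
          conn {c} c<1+k with ℕ.m<1+n⇒m<n∨m≡n c<1+k
          ... | inj₁ c<k  = λ p q → conn-recolour (conn-recolour (connected base c<k p q))
          ... | inj₂ refl = through toHub
            where
            toHub : ∀ p → Conn G col k (τ p) (τ l)
            toHub p with other-two i≢j i≢l j≢l p
            ... | inj₁ refl        = link-recolour je
            ... | inj₂ (inj₁ refl) = conn-recolour (link-recolour (delete-joined f≢e jf))
            ... | inj₂ (inj₂ refl) = ε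
    largest : Packing G (suc k)
    largest with ℕ.≤-total (degree G zero) (degree G (suc zero))
               | ℕ.≤-total (degree G zero) (degree G (suc (suc zero)))
               | ℕ.≤-total (degree G (suc zero)) (degree G (suc (suc zero)))
    ... | inj₁ 0≤1 | _        | inj₂ 2≤1 = step {zero} {suc (suc zero)} {suc zero} (λ ()) (λ ())
      (λ ())
          (λ d → swap-last (d zero) (d (suc zero)) (d (suc (suc zero)))) 0≤1 2≤1
    ... | inj₁ 0≤1 | _        | inj₁ 1≤2 = step {zero} {suc zero} {suc (suc zero)} (λ ()) (λ ())
      (λ ()) (λ _ → refl) (ℕ.≤-trans 0≤1 1≤2) 1≤2
    ... | inj₂ 1≤0 | inj₁ 0≤2 | _        = step {zero} {suc zero} {suc (suc zero)} (λ ()) (λ ())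
      (λ ()) (λ _ → refl) 0≤2 (ℕ.≤-trans 1≤0 0≤2)
    ... | inj₂ 1≤0 | inj₂ 2≤0 | _        = step {suc zero} {suc (suc zero)} {zero} (λ ()) (λ ())
      (λ ())
          (λ d → rotate (d zero) (d (suc zero)) (d (suc (suc zero)))) 1≤0 2≤0

  -- Tight sets and irreducible multigraphs

  Isolates : Fin 3 → VertexSet n → Set
  Isolates i X = ∀ j → X (τ j) ≡ does (i Fin.≟ j)

  CutCondition : Multigraph m n → ℕ → Set
  CutCondition G ℓ = ∀ i X → Isolates i X → ℓ ≤ cut G X

  isolates-self : ∀ {i X} → Isolates i X → X (τ i) ≡ true
  isolates-self {i} iso = trans (iso i) (dec-true (i Fin.≟ i) refl)

  full : VertexSet n
  full = const true

  -- Here `b` tells whether the centre lies in the isolating set: if not, only the leg to the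
  -- isolated terminal crosses; if so, the other two legs do.
  tripod-drop : ∀ b (i : Fin 3) →
    𝟙 (b xor does (i Fin.≟ zero)) +
    (𝟙 (b xor does (i Fin.≟ suc zero)) + 𝟙 (b xor does (i Fin.≟ suc (suc zero)))) ≡ suc (𝟙 b)
  tripod-drop true  zero = refl
  tripod-drop true  (suc zero) = refl
  tripod-drop true  (suc (suc zero)) = refl
  tripod-drop false zero = refl
  tripod-drop false (suc zero) = refl
  tripod-drop false (suc (suc zero)) = refl

  anyIsolating? : ∀ i {P : VertexSet n → Set} → (∀ X → Dec (P X)) → (∀ {X Y} → X ≗ Y → P X → P Y) →
                  Dec (∃ λ X → Isolates i X × P X)
  anyIsolating? i P? resp = anyVertexSet? (λ X → Fin.all?
    (λ j → X (τ j) Bool.≟ does (i Fin.≟ j)) ×-dec P? X)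
    λ X≗Y (iso , p) → (λ j → trans (sym (X≗Y (τ j))) (iso j)) , resp X≗Y p

  innerEdge-cong : ∀ {G X Y e} → X ≗ Y → InnerEdge G X e → InnerEdge G Y e
  innerEdge-cong {G} {X} {Y} {e} X≗Y (innerEdge nl i) = innerEdge nl
    (trans (sym (cong₂ _∧_ (X≗Y (src G e)) (X≗Y (tgt G e)))) i)

  Violated : Multigraph m n → ℕ → Set
  Violated G ℓ = ∃ λ i → ∃ λ X → Isolates i X × cut G X < ℓ

  violated? : ∀ G ℓ → Dec (Violated G ℓ)
  violated? G ℓ = Fin.any? λ i → anyIsolating? i (λ X → cut G X ℕ.<? ℓ) λ X≗Y → subst (_< ℓ)
    (cut-cong G X≗Y)

  -- Under the cut condition, `cut G X ≤ ℓ` says that `X` is tight.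
  Contractible : Multigraph m n → ℕ → Set
  Contractible G ℓ = ∃ λ i → ∃ λ X → Isolates i X × cut G X ≤ ℓ × ∃ λ e → InnerEdge G X e

  contractible? : ∀ G ℓ → Dec (Contractible G ℓ)
  contractible? G ℓ = Fin.any? λ i → anyIsolating? i
    (λ X → (cut G X ℕ.≤? ℓ) ×-dec Fin.any? (innerEdge? G X))
    λ X≗Y (le , e , b) → subst (_≤ ℓ) (cut-cong G X≗Y) le , e , innerEdge-cong X≗Y b

  star-isolates : ∀ i → Isolates i (star i)
  star-isolates i = star-τ i

  module Irreducible {G ℓ} (cond : CutCondition G ℓ)
    (critical : ∀ e → NonLoop G e → Violated (delete G e) ℓ)
      (¬contractible : ¬ Contractible G ℓ) where

    -- A set violated by deleting `e` is tight and crossed by `e`; as nothing is contractible, it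
    -- has no inner edge. Its leaving edges are then those of its terminal, `e` among them.
    tight-end : ∀ e → NonLoop G e → ∃₂ λ i w → Joined G e (τ i) w × degree G i ≤ ℓ
    tight-end e nl = go (critical e nl)
      where
      go : Violated (delete G e) ℓ → ∃₂ λ i w → Joined G e (τ i) w × degree G i ≤ ℓ
      go (i , X , iso , lt) =
        let c , X≤ℓ = delete-drops-cut {G} {X} lt (cond i X iso)
            bare : ∀ {e} → ¬ InnerEdge G X e
            bare = λ b → ¬contractible (i , X , iso , X≤ℓ , _ , b)
            Xτ = isolates-self {i} {X} iso
            w , j = cross-singleton⁻ {G} {τ i} {e}
              (bare⇒cross-star Xτ bare (ℕ.≤-trans X≤ℓ (cond i (star i) (star-isolates i))) c)
        in i , w , j , ℕ.≤-trans (bare⇒cut≥star Xτ bare) X≤ℓ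

    module NonTerminal (v : Fin n) (v∉τ : ∀ i → τ i ≢ v) where

      pairSet : Fin 3 → VertexSet n
      pairSet i = star i ∪ₛ singleton v

      pairSet-isolates : ∀ i → Isolates i (pairSet i)
      pairSet-isolates i j = trans (cong₂ _∨_ (star-τ i j) (singleton-other (v∉τ j ∘ sym)))
        (Bool.∨-identityʳ _)

      terminal-neighbour : ∀ {e} → cross G (singleton v) e ≡ true → ∃ λ i → Joined G e v (τ i) ×
          degree G i ≤ ℓ
      terminal-neighbour {e} c = go (cross-singleton⁻ c)
        (tight-end e (cross⇒nonLoop G (singleton v) c))
        where
        other : ∀ {u w a} → Joined G e v u → Joined G e a w → a ≢ v → u ≡ a
        other (fwd p) (fwd q) a≢v = contradiction (cong proj₁ (trans (sym q) p)) a≢v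
        other (fwd p) (bwd q) a≢v = cong proj₂ (trans (sym p) q)
        other (bwd p) (fwd q) a≢v = cong proj₁ (trans (sym p) q)
        other (bwd p) (bwd q) a≢v = contradiction (cong proj₂ (trans (sym q) p)) a≢v
        go : (∃ λ u → Joined G e v u) → (∃₂ λ i w → Joined G e (τ i) w × degree G i ≤ ℓ) →
             ∃ λ i → Joined G e v (τ i) × degree G i ≤ ℓ
        go (u , j) (i , w , j′ , d) = i , subst (Joined G e v) (other j j′ (v∉τ i)) j , d

      -- Otherwise `e` would be an inner edge of a tight set. Arbitrary sets are covered, not only
      -- pairs, because removing the tripod costs two in every isolating set that contains `v`.
      not-tight : ∀ {e i} X → X v ≡ true → Isolates i X → Joined G e v (τ i) → ℓ < cut G X
      not-tight {e} {i} X Xv iso j = ℕ.≰⇒> λ le → ¬contractible (i , X , iso , le , e ,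
        innerEdge (joined⇒nonLoop j (v∉τ i ∘ sym))
          (trans (joined⇒inner X j) (cong₂ _∧_ Xv (isolates-self {i} {X} iso))))

      pairSet-v : ∀ i → pairSet i v ≡ true
      pairSet-v i = trans (cong (star i v ∨_) (singleton-self v)) (Bool.∨-zeroʳ (star i v))

      pairSet-not-tight : ∀ {e i} → Joined G e v (τ i) → ℓ < cut G (pairSet i)
      pairSet-not-tight {i = i} = not-tight (pairSet i) (pairSet-v i) (pairSet-isolates i)

      -- Adding `v` to the star enlarges the cut, so some edge leaves the pair but not the star: it
      -- goes from `v` to a vertex other than `τ i`, and that vertex is a terminal.
      second : ∀ {e i} → Joined G e v (τ i) → degree G i ≤ ℓ →
               ∃₂ λ f j → i ≢ j × Joined G f v (τ j) × degree G j ≤ ℓ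
      second {e} {i} je d≤ = go (sum-<⇒∃< (𝟙 ∘ cross G (star i)) (𝟙 ∘ cross G (pairSet i))
        (ℕ.≤-<-trans d≤ (pairSet-not-tight je)))
        where
        go : (∃ λ f → 𝟙 (cross G (star i) f) < 𝟙 (cross G (pairSet i) f)) →
             ∃₂ λ f j → i ≢ j × Joined G f v (τ j) × degree G j ≤ ℓ
        go (f , lt) =
          let ¬c , c = 𝟙-< lt
              w , jw , w≢ = cross-pair c ¬c
              v≢w = joined-≢ jw (cross⇒nonLoop G (pairSet i) c)
              j , jτ , d = terminal-neighbour (cross-singleton⁺ jw v≢w)
          in f , j , (λ i≡j → w≢ (trans (joined-unique jw jτ) (cong τ (sym i≡j)))) , jτ , d

      -- If all edges at v went to τ i or τ j, then adding v to both stars would leave the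
      -- sum of the two cuts unchanged.
      third : ∀ {e f i j} → Joined G e v (τ i) → Joined G f v (τ j) → degree G i ≤ ℓ →
          degree G j ≤ ℓ →
              ∃₂ λ h k → i ≢ k × j ≢ k × Joined G h v (τ k)
      third {e} {f} {i} {j} je jf di dj = go (sum-<⇒∃<
          (λ h → 𝟙 (cross G (star i) h) + 𝟙 (cross G (star j) h))
          (λ h → 𝟙 (cross G (pairSet i) h) + 𝟙 (cross G (pairSet j) h))
          (subst₂ _<_ (sym (∑-distrib-+ (𝟙 ∘ cross G (star i)) (𝟙 ∘ cross G (star j))))
                      (sym (∑-distrib-+ (𝟙 ∘ cross G (pairSet i)) (𝟙 ∘ cross G (pairSet j))))
            (ℕ.+-mono-< (ℕ.≤-<-trans di (pairSet-not-tight je))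
              (ℕ.≤-<-trans dj (pairSet-not-tight jf)))))
        where
        Excess : Fin m → Fin 3 → Fin 3 → Set
        Excess h i j = 𝟙 (cross G (star i) h) + 𝟙 (cross G (star j) h) < 𝟙
          (cross G (pairSet i) h) + 𝟙 (cross G (pairSet j) h)
        -- An edge from `v` to `τ i` has no excess: it lies inside `pairSet i`, counts at most once
        -- for `pairSet j`, and already once for `star i`.
        avoids : ∀ {h k} i j → Excess h i j → Joined G h v (τ k) → i ≢ k
        avoids {h} i j lt jk refl = ℕ.<⇒≱ lt (ℕ.≤-trans
          (ℕ.+-mono-≤ (ℕ.≤-reflexive (cong 𝟙 inside-pair)) (𝟙≤1 (cross G (pairSet j) h)))
          (ℕ.≤-trans (ℕ.≤-reflexive (cong 𝟙 (sym (cross-singleton⁺ (joined-sym jk) (v∉τ i)))))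
            (ℕ.m≤m+n _ _)))
          where
          inside-pair : cross G (pairSet i) h ≡ false
          inside-pair = trans (joined⇒cross (pairSet i) jk)
            (cong₂ _xor_ (pairSet-v i) (isolates-self {i} {pairSet i} (pairSet-isolates i)))
        uncrossed : ∀ h i → cross G (singleton v) h ≡ false →
            𝟙 (cross G (pairSet i) h) ≤ 𝟙 (cross G (star i) h)
        uncrossed h i = absorb {star i (src G h)} {singleton v (src G h)}
          where
          absorb : ∀ {p q p′ q′} → q xor q′ ≡ false → 𝟙 ((p ∨ q) xor (p′ ∨ q′)) ≤ 𝟙 (p xor p′)
          absorb {p} {true}  {p′} {true}  _ rewrite Bool.∨-zeroʳ p | Bool.∨-zeroʳ p′ = z≤n
          absorb {p} {false} {p′} {false} _ rewrite Bool.∨-identityʳ p | Bool.∨-identityʳ p′ =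
            ℕ.≤-refl
        at-v : ∀ {h} → Excess h i j → cross G (singleton v) h ≡ true
        at-v {h} lt with cross G (singleton v) h in c
        ... | true  = refl
        ... | false = contradiction (ℕ.+-mono-≤ (uncrossed h i c) (uncrossed h j c)) (ℕ.<⇒≱ lt)
        go : (∃ λ h → Excess h i j) → ∃₂ λ h k → i ≢ k × j ≢ k × Joined G h v (τ k)
        go (h , lt) =
          let k , jk , _ = terminal-neighbour (at-v lt)
          in h , k , avoids i j lt jk
               , avoids j i (subst₂ _<_ (ℕ.+-comm (𝟙 (cross G (star i) h)) _)
                 (ℕ.+-comm (𝟙 (cross G (pairSet i) h)) _) lt) jk
               , jk

      tripod : ∀ {e} → cross G (singleton v) e ≡ true → ∀ l → ∃ λ e → Joined G e v (τ l)
      tripod {e} c l =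
        let i , je , di = terminal-neighbour c
            f , j , i≢j , jf , dj = second je di
            h , k , i≢k , j≢k , jh = third je jf di dj
        in go je jf jh (other-two i≢j i≢k j≢k l)
        where
        go : ∀ {e f h i j k} → Joined G e v (τ i) → Joined G f v (τ j) → Joined G h v (τ k) →
             l ≡ i ⊎ l ≡ j ⊎ l ≡ k → ∃ λ e → Joined G e v (τ l)
        go je jf jh (inj₁ refl)        = _ , je
        go je jf jh (inj₂ (inj₁ refl)) = _ , jf
        go je jf jh (inj₂ (inj₂ refl)) = _ , jh

  module Tripod {G v} (v∉τ : ∀ i → τ i ≢ v) {e₀ e₁ e₂} (j₀ : Joined G e₀ v (τ zero))
    (j₁ : Joined G e₁ v (τ (suc zero))) (j₂ : Joined G e₂ v (τ (suc (suc zero)))) where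

    G₁ G₂ G₃ : Multigraph m n
    G₁ = delete G e₀
    G₂ = delete G₁ e₁
    G₃ = delete G₂ e₂

    apart : ∀ {e f i j} → i ≢ j → Joined G e v (τ i) → Joined G f v (τ j) → f ≢ e
    apart i≢j je jf refl = i≢j (τ-injective (joined-unique je jf))

    e₁≢e₀ : e₁ ≢ e₀
    e₁≢e₀ = apart (λ ()) j₀ j₁

    j₁′ : Joined G₁ e₁ v (τ (suc zero))
    j₁′ = delete-joined e₁≢e₀ j₁

    j₂′ : Joined G₁ e₂ v (τ (suc (suc zero)))
    j₂′ = delete-joined (apart (λ ()) j₀ j₂) j₂

    j₂″ : Joined G₂ e₂ v (τ (suc (suc zero)))
    j₂″ = delete-joined (apart (λ ()) j₁ j₂) j₂′

    cut-loss : ∀ i X → Isolates i X → cut G X ≡ suc (𝟙 (X v)) + cut G₃ X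
    cut-loss i X iso = begin
      cut G X                                                      ≡⟨ cut-delete G X e₀ ⟩
      𝟙 (cross G X e₀) + cut G₁ X                                  ≡⟨ cong₂ _+_ (value j₀)
        (cut-delete G₁ X e₁) ⟩
      t zero + (𝟙 (cross G₁ X e₁) + cut G₂ X)                      ≡⟨ cong₂
        (λ a b → t zero + (a + b)) (value j₁′) (cut-delete G₂ X e₂) ⟩
      t zero + (t (suc zero) + (𝟙 (cross G₂ X e₂) + cut G₃ X))
        ≡⟨ cong (λ a → t zero + (t (suc zero) + (a + cut G₃ X))) (value j₂″) ⟩
      t zero + (t (suc zero) + (t (suc (suc zero)) + cut G₃ X))    ≡⟨ assoc (t zero) (t (suc zero))
        (t (suc (suc zero))) (cut G₃ X) ⟩
      t zero + (t (suc zero) + t (suc (suc zero))) + cut G₃ X      ≡⟨ cong (_+ cut G₃ X)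
        (tripod-drop (X v) i) ⟩
      suc (𝟙 (X v)) + cut G₃ X                                     ∎
      where
      open ≡-Reasoning
      t : Fin 3 → ℕ
      t l = 𝟙 (X v xor does (i Fin.≟ l))
      value : ∀ {H e l} → Joined H e v (τ l) → 𝟙 (cross H X e) ≡ t l
      value {l = l} j = cong 𝟙 (trans (joined⇒cross X j) (cong (X v xor_) (iso l)))
      assoc : ∀ a b c d → a + (b + (c + d)) ≡ a + (b + c) + d
      assoc = solve 4 (λ a b c d → a :+ (b :+ (c :+ d)) := a :+ (b :+ c) :+ d) refl
        where open +-*-Solver

    condition : ∀ {ℓ} → CutCondition G (suc ℓ) →
        (∀ i X → X v ≡ true → Isolates i X → suc ℓ < cut G X) → CutCondition G₃ ℓ
    condition {ℓ} cond strict i X iso with X v in Xv | cut-loss i X iso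
    ... | true  | eq = ℕ.≤-pred (ℕ.≤-pred (subst (suc ℓ <_) eq (strict i X Xv iso)))
    ... | false | eq = ℕ.≤-pred (subst (suc ℓ ≤_) eq (cond i X iso))

    lighter : innerSize G₃ full < innerSize G full
    lighter = innerSize-< {X = full} {full} (proj₂ ∘ delete-innerEdge ∘ proj₂ ∘ delete-innerEdge ∘
      proj₂ ∘ delete-innerEdge)
      (λ b → proj₁ (delete-innerEdge (proj₂ (delete-innerEdge (proj₂ (delete-innerEdge b))))) refl)
      (innerEdge (joined⇒nonLoop j₀ (v∉τ zero ∘ sym)) refl)

    extend : ∀ {k} → Packing G₃ k → Packing G (suc k)
    extend {k} base = record { colour = col ; connected = conn }
      where
      col : Fin m → ℕ
      col = recolour (recolour (recolour (colour base) e₂ k) e₁ k) e₀ k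
      conn : ∀ {c} → c < suc k → ∀ p q → Conn G col c (τ p) (τ q)
      conn {c} c<1+k with ℕ.m<1+n⇒m<n∨m≡n c<1+k
      ... | inj₁ c<k  = λ p q → conn-recolour
        (conn-recolour (conn-recolour (connected base c<k p q)))
      ... | inj₂ refl = through toHub
        where
        toHub : ∀ p → Conn G col k (τ p) v
        toHub zero             = link-recolour (joined-sym j₀)
        toHub (suc zero)       = conn-recolour (link-recolour (joined-sym j₁′))
        toHub (suc (suc zero)) = conn-recolour (conn-recolour (link-recolour (joined-sym j₂″)))

  -- A cut of the contraction is the cut of a preimage under `collapse`. Terminals are fixed: the
  -- only one in `X` is `τ i`, the point contracted to.
  condition-contract : ∀ {G ℓ i X} → CutCondition G ℓ → Isolates i X →
      CutCondition (contract G X (τ i)) ℓ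
  condition-contract {G} {ℓ} {i} {X} cond iso j Z iso′ = cond j (Z ∘ collapse X (τ i)) λ l → trans
    (cong Z (fixed l)) (iso′ l)
    where
    fixed : ∀ l → collapse X (τ i) (τ l) ≡ τ l
    fixed l with i Fin.≟ l | iso l
    ... | yes refl | eq rewrite eq = refl
    ... | no _     | eq rewrite eq = refl

  packing-contract : ∀ {G X a o k} → Fan G X a o → Packing (contract G X a) k → Packing G k
  packing-contract {o = o} fan base = record
    { colour = colour base ∘ o ; connected = λ c<k i j → conn-contract fan
      (connected base c<k i j) }

  packing-delete : ∀ {G e k} → Packing (delete G e) k → Packing G k
  packing-delete base = record
    { colour = colour base ; connected = λ c<k i j → conn-delete (λ _ → refl)
      (connected base c<k i j) }

  three-degrees : ∀ {G ℓ k} → CutCondition G ℓ → 4 * k ≤ suc (3 * ℓ) → 4 * k ≤ suc (total G)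
  three-degrees {G} {ℓ} cond le = ℕ.≤-trans le (s≤s (ℕ.≤-trans
    (ℕ.≤-reflexive (solve 1 (λ ℓ → con 3 :* ℓ := ℓ :+ ℓ :+ ℓ) refl ℓ))
    (ℕ.+-mono-≤ (ℕ.+-mono-≤ (deg zero) (deg (suc zero))) (deg (suc (suc zero))))))
    where
    open +-*-Solver
    deg : ∀ i → ℓ ≤ degree G i
    deg i = cond i (star i) (star-isolates i)

  k≤ℓ : ∀ {k ℓ} → 4 * k ≤ suc (3 * ℓ) → k ≤ ℓ
  k≤ℓ {k} {ℓ} le = ℕ.≮⇒≥ λ ℓ<k → ℕ.<⇒≱ (begin-strict
    suc (3 * ℓ)    <⟨ ℕ.m<m+n (suc (3 * ℓ)) {ℓ + 3} (ℕ.≤-trans (s≤s z≤n) (ℕ.m≤n+m 3 ℓ)) ⟩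
    suc (3 * ℓ) + (ℓ + 3)  ≡⟨ solve 1 (λ ℓ → con 1 :+ con 3 :* ℓ :+ (ℓ :+ con 3) := con 4 :*
      (con 1 :+ ℓ)) refl ℓ ⟩
    4 * suc ℓ      ≤⟨ ℕ.*-monoʳ-≤ 4 ℓ<k ⟩
    4 * k          ∎) le
    where
    open +-*-Solver
    open ℕ.≤-Reasoning

  -- Lowering both by one takes four from the left side and only three from the right, so tripods
  -- never limit the number of trees.
  fewer-trees : ∀ {k ℓ} → 4 * suc k ≤ suc (3 * suc ℓ) → 4 * k ≤ suc (3 * ℓ)
  fewer-trees {k} {ℓ} le = ℕ.+-cancelʳ-≤ 4 _ _ (begin
    4 * k + 4            ≡⟨ solve 1 (λ k → con 4 :* k :+ con 4 := con 4 :* (con 1 :+ k)) refl k ⟩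
    4 * suc k            ≤⟨ le ⟩
    suc (3 * suc ℓ)      ≡⟨ solve 1 (λ ℓ → con 1 :+ con 3 :*
      (con 1 :+ ℓ) := con 1 :+ con 3 :* ℓ :+ con 3) refl ℓ ⟩
    suc (3 * ℓ) + 3      ≤⟨ ℕ.+-monoʳ-≤ (suc (3 * ℓ)) (ℕ.n≤1+n 3) ⟩
    suc (3 * ℓ) + 4      ∎)
    where
    open +-*-Solver
    open ℕ.≤-Reasoning

  -- The inequality says k ≤ ⌊⌈3ℓ/2⌉/2⌋, which is 3s + ⌈r/2⌉ for ℓ = 4s + r.
  pack : ∀ N G ℓ k → innerSize G full < N → 4 * k ≤ suc (3 * ℓ) → CutCondition G ℓ → Packing G k
  pack (suc N) G ℓ       zero    _            _  _    = no-packing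
  pack (suc N) G zero    (suc k) _            le _    = contradiction (k≤ℓ {suc k} {0} le) λ ()
  pack (suc N) G (suc ℓ) (suc k) (s≤s innerSize≤N) le cond =
    byDeletion (Fin.any? λ e → nonLoop? G e ×-dec ¬? (violated? (delete G e) (suc ℓ)))
    where
    byIrreducibility : (∀ e → NonLoop G e → Violated (delete G e) (suc ℓ)) →
        ¬ Contractible G (suc ℓ) → Packing G (suc k)
    byIrreducibility critical ¬contractible = byTripod
      (Fin.any? λ v → Fin.all? (λ i → ¬? (τ i Fin.≟ v)) ×-dec Fin.any? λ e → cross G
      (singleton v) e Bool.≟ true)
      where
      open Irreducible {G} {suc ℓ} cond critical ¬contractible
      byTripod : Dec (∃ λ v → (∀ i → τ i ≢ v) × ∃ λ e → cross G (singleton v) e ≡ true) →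
          Packing G (suc k)
      byTripod (yes (v , v∉τ , e , c)) = withTripod (tripod c zero) (tripod c (suc zero))
        (tripod c (suc (suc zero)))
        where
        open NonTerminal v v∉τ
        withTripod : (∃ λ e → Joined G e v (τ zero)) → (∃ λ e → Joined G e v (τ (suc zero))) →
                     (∃ λ e → Joined G e v (τ (suc (suc zero)))) → Packing G (suc k)
        withTripod (e₀ , j₀) (e₁ , j₁) (e₂ , j₂) = extend
          (pack N G₃ ℓ k (ℕ.<-≤-trans lighter innerSize≤N) (fewer-trees {k} {ℓ} le)
            (condition {ℓ} cond strict))
          where
          open Tripod {G} {v} v∉τ {e₀} {e₁} {e₂} j₀ j₁ j₂
          to : ∀ i → ∃ λ e → Joined G e v (τ i)
          to zero             = e₀ , j₀
          to (suc zero)       = e₁ , j₁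
          to (suc (suc zero)) = e₂ , j₂
          strict : ∀ i X → X v ≡ true → Isolates i X → suc ℓ < cut G X
          strict i X Xv iso = not-tight X Xv iso (proj₂ (to i))
      byTripod (no ¬∃) = pack-terminals (suc k) G only
        (λ i → ℕ.≤-trans (k≤ℓ {suc k} {suc ℓ} le) (cond i (star i) (star-isolates i)))
          (three-degrees {G} {suc ℓ} {suc k} cond le)
        where
        only : OnlyTerminals G
        only {e} {u} j u≢v with Fin.any? (λ i → τ i Fin.≟ u)
        ... | yes (i , eq) = i , sym eq
        ... | no  ¬τ       = contradiction (u , (λ i eq → ¬τ (i , eq)) , e ,
          cross-singleton⁺ j u≢v) ¬∃

    byContraction : (∀ e → NonLoop G e → Violated (delete G e) (suc ℓ)) →
        Dec (Contractible G (suc ℓ)) → Packing G (suc k)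
    byContraction critical (no ¬contractible) = byIrreducibility critical ¬contractible
    byContraction critical (yes (i , X , iso , X≤ℓ , e , b)) = packing-contract (proj₂ fan)
      (pack N (contract G X (τ i)) (suc ℓ) (suc k)
        (ℕ.<-≤-trans (innerSize-< {X = full} {full} smaller loop
          (innerEdge (InnerEdge.nonLoop b) refl)) innerSize≤N) le
          (condition-contract {G} {X = X} cond iso))
      where
      fan : ∃ (Fan G X (τ i))
      -- A set between `τ i` and `X` isolates `τ i` as well, so its cut has at least `suc ℓ` edges,
      -- and the tight `X` is a least cut.
      fan = menger (suc (innerSize G X)) G X (τ i) ℕ.≤-refl (isolates-self {i} {X} iso) λ Y Yτ Y⊑X →
        ℕ.≤-trans X≤ℓ (cond i Y (sub Yτ Y⊑X))
        where
        sub : ∀ {Y} → Y (τ i) ≡ true → Y ⊑ X → Isolates i Y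
        sub {Y} Yτ Y⊑X j with i Fin.≟ j | iso j
        ... | yes refl | _  = Yτ
        ... | no _     | eq with Y (τ j) in Yj
        ...   | false = refl
        ...   | true  = trans (sym (Y⊑X (τ j) Yj)) eq
      smaller : ∀ {e} → InnerEdge (contract G X (τ i)) full e → InnerEdge G full e
      smaller (innerEdge nl _) = innerEdge (proj₁ (contract-nonLoop {G} {X} nl)) refl
      loop : ¬ InnerEdge (contract G X (τ i)) full e
      loop (innerEdge nl _) = contradiction (trans (sym (InnerEdge.both b))
        (proj₂ (contract-nonLoop {G} {X} nl))) λ ()

    byDeletion : Dec (∃ λ e → NonLoop G e × ¬ Violated (delete G e) (suc ℓ)) → Packing G (suc k)
    byDeletion (yes (e , nl , ¬viol)) = packing-delete (pack N (delete G e) (suc ℓ) (suc k)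
      (ℕ.<-≤-trans (innerSize-< {X = full} {full} (proj₂ ∘ delete-innerEdge)
        (λ b → proj₁ (delete-innerEdge b) refl) (innerEdge nl refl)) innerSize≤N) le
      λ i X iso → ℕ.≮⇒≥ λ lt → ¬viol (i , X , iso , lt))
    byDeletion (no ¬∃) = byContraction
      (λ e nl → decidable-stable (violated? (delete G e) (suc ℓ)) λ ¬viol → ¬∃ (e , nl , ¬viol))
      (contractible? G (suc ℓ))

-- From colour classes to trees in simple graphs

∈-tabulate⁺ : ∀ {m} {p : Fin m → Bool} {e} → p e ≡ true → e ∈ tabulate p
∈-tabulate⁺ {p = p} {e} eq = lookup⇒[]= e (tabulate p) (trans (lookup∘tabulate p e) eq)

∈-tabulate⁻ : ∀ {m} {p : Fin m → Bool} {e} → e ∈ tabulate p → p e ≡ true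
∈-tabulate⁻ {p = p} {e} e∈ = trans (sym (lookup∘tabulate p e)) ([]=⇒lookup e∈)

∣tabulate∣≡sum : ∀ {m} (p : Fin m → Bool) → ∣ tabulate p ∣ ≡ sum (𝟙 ∘ p)
∣tabulate∣≡sum {zero}  p = refl
∣tabulate∣≡sum {suc m} p with p zero
... | true  = cong suc (∣tabulate∣≡sum (p ∘ suc))
... | false = ∣tabulate∣≡sum (p ∘ suc)

record Enumeration {n} (S : Subset n) (k : ℕ) : Set where
  field
    element   : Fin k → Fin n
    injective : ∀ {i j} → element i ≡ element j → i ≡ j
    member    : ∀ i → element i ∈ S
    onto      : ∀ {x} → x ∈ S → ∃ λ i → element i ≡ x

enumerate : ∀ {n} (S : Subset n) → Enumeration S ∣ S ∣
enumerate Vec.[] = record { element = λ () ; injective = λ { {()} } ; member = λ () ; onto = λ () }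
enumerate (outside Vec.∷ S) = record
  { element   = suc ∘ element
  ; injective = injective ∘ Fin.suc-injective
  ; member    = Vec.there ∘ member
  ; onto      = λ { (Vec.there x∈) → let i , eq = onto x∈ in i , cong suc eq }
  }
  where open Enumeration (enumerate S)
enumerate (inside Vec.∷ S) = record
  { element   = λ { zero → zero ; (suc i) → suc (element i) }
  ; injective = λ { {zero} {zero} _ → refl ; {suc i} {suc j} eq → cong suc
    (injective (Fin.suc-injective eq)) }
  ; member    = λ { zero → Vec.here ; (suc i) → Vec.there (member i) }
  ; onto      = λ { Vec.here → zero , refl ; (Vec.there x∈) → let i , eq = onto x∈ in suc i ,
    cong suc eq }
  }
  where open Enumeration (enumerate S)

module _ {n} (G : Graph n) where
  open Multi {size G} {n}

  ends : Multigraph (size G) n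
  ends e = source G e , target G e

  -- Once the edges crossing `X` are deleted, membership in `X` is constant along every walk.
  edgeConnectivity≤cut : ∀ .(2≤n : 2 ≤ n) X {u v} → X u ≡ true → X v ≡ false →
      edgeConnectivity G 2≤n ≤ cut ends X
  edgeConnectivity≤cut 2≤n X {u} {v} Xu Xv = Minimum.least (minimumDisconnectingSize G 2≤n)
    (tabulate (cross ends X) , separated , ∣tabulate∣≡sum (cross ends X))
    where
    uncut : ∀ {u v} → Adjacent (deleteEdges G (tabulate (cross ends X))) u v → X u ≡ X v
    uncut {u} {v} (e , e∈ , joins) with cross ends X e in c
    ... | true  = contradiction (∈-tabulate⁺ c) (Sub.x∈∁p⇒x∉p e∈)
    ... | false = same joins
      where
      xor-false : ∀ {a b} → a xor b ≡ false → a ≡ b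
      xor-false {true}  {true}  _ = refl
      xor-false {false} {false} _ = refl
      same : Joins G e u v → X u ≡ X v
      same (inj₁ (refl , refl)) = xor-false c
      same (inj₂ (refl , refl)) = sym (xor-false c)
    separated : ¬ IsConnected (deleteEdges G (tabulate (cross ends X)))
    separated (_ , conn) = contradiction (trans (sym Xu)
      (trans (Star.fold (λ a b → X a ≡ X b) (λ a → trans (uncut a)) refl (conn Sub.∈⊤ Sub.∈⊤)) Xv))
      λ ()

module _ {n} {G : Graph n} where

  joins-sym : ∀ {e u v} → Joins G e u v → Joins G e v u
  joins-sym (inj₁ p) = inj₂ p
  joins-sym (inj₂ p) = inj₁ p

  adjacent-sym : ∀ {H : Subgraph G} {u v} → Adjacent H u v → Adjacent H v u
  adjacent-sym (e , e∈ , j) = e , e∈ , joins-sym j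

  _-ₑ_ : Subgraph G → Fin (size G) → Subgraph G
  H -ₑ e = subgraph (vertices H) (edges H - e) λ e′∈ → endpoints-∈ H (Sub.p─q⊆p (edges H) ⁅ e ⁆ e′∈)

  -- The rest of the cycle bypasses its first edge. As no vertex repeats, every other edge of the
  -- cycle has an end different from `s` and `x`, so it is not `e`.
  cycle-edge : ∀ {H : Subgraph G} → Cycle H → ∃₂ λ e u → ∃ λ v → e ∈ edges H × Joins G e u v ×
      Star (Adjacent (H -ₑ e)) v u
  cycle-edge record { rest = [] ; length≥3 = s≤s () }
  cycle-edge record { rest = _ ∷ [] ; length≥3 = s≤s (s≤s ()) }
  cycle-edge {H} record { start = s ; rest = x ∷ y ∷ ys ; no-repeats =
    (s≢x ListAll.∷ s≢y ListAll.∷ s≢ys) ListAllPairs.∷ (x≢y ListAll.∷ x≢ys) ListAllPairs.∷ _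
                        ; closed-walk = (e , e∈ , sx) Linked.∷ ((f , f∈ , xy) Linked.∷ walk) } =
    e , s , x , e∈ , sx , bypass f∈ (joins-sym xy) (s≢y ∘ sym) (x≢y ∘ sym) (joins-sym ∘ id) ◅ follow
      (s≢y , x≢y) s≢ys x≢ys walk
    where
    other : ∀ {f u v} → Joins G f u v → Joins G e s x → u ≢ s → u ≢ x → f ≢ e
    other (inj₁ (refl , _)) (inj₁ (p , _)) u≢s u≢x refl = u≢s p
    other (inj₁ (refl , _)) (inj₂ (p , _)) u≢s u≢x refl = u≢x p
    other (inj₂ (_ , refl)) (inj₁ (_ , p)) u≢s u≢x refl = u≢x p
    other (inj₂ (_ , refl)) (inj₂ (_ , p)) u≢s u≢x refl = u≢s p
    bypass : ∀ {f u v a b} → f ∈ edges H → Joins G f u v → u ≢ s → u ≢ x →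
        (Joins G f u v → Joins G f a b) → Adjacent (H -ₑ e) a b
    bypass f∈ j u≢s u≢x turn = _ , Sub.x∈p∧x≢y⇒x∈p-y f∈ (other j sx u≢s u≢x) , turn j
    follow : ∀ {z zs} → s ≢ z × x ≢ z → ListAll.All (s ≢_) zs → ListAll.All (x ≢_) zs →
             Linked (Adjacent H) (z ∷ (zs ∷ʳ s)) → Star (Adjacent (H -ₑ e)) z s
    follow {zs = []} (s≢z , x≢z) _ _ ((f , f∈ , j) Linked.∷ _) = bypass f∈ j (s≢z ∘ sym)
      (x≢z ∘ sym) id ◅ ε
    follow {zs = w ∷ ws} (s≢z , x≢z) (s≢w ListAll.∷ s≢ws) (x≢w ListAll.∷ x≢ws)
      ((f , f∈ , j) Linked.∷ walk) =
      bypass f∈ j (s≢z ∘ sym) (x≢z ∘ sym) id ◅ follow (s≢w , x≢w) s≢ws x≢ws walk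

  cycle-edge-removable : ∀ {H : Subgraph G} → IsConnected H → Cycle H → ∃ λ e → e ∈ edges H ×
      IsConnected (H -ₑ e)
  cycle-edge-removable {H} (ne , conn) cyc with cycle-edge cyc
  ... | e , u , v , e∈ , uv , detour = e , e∈ , ne , λ a∈ b∈ → (reroute Star.⋆) (conn a∈ b∈)
    where
    back : Star (Adjacent (H -ₑ e)) u v
    back = Star.reverse (adjacent-sym {H -ₑ e}) detour
    along : ∀ {a b} → Joins G e a b → Joins G e u v → Star (Adjacent (H -ₑ e)) a b
    along (inj₁ (refl , refl)) (inj₁ (refl , refl)) = back
    along (inj₁ (refl , refl)) (inj₂ (refl , refl)) = detour
    along (inj₂ (refl , refl)) (inj₁ (refl , refl)) = detour
    along (inj₂ (refl , refl)) (inj₂ (refl , refl)) = back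
    reroute : ∀ {a b} → Adjacent H a b → Star (Adjacent (H -ₑ e)) a b
    reroute (f , f∈ , j) with f Fin.≟ e
    ... | yes refl = along j uv
    ... | no f≢e   = (f , Sub.x∈p∧x≢y⇒x∈p-y f∈ f≢e , j) ◅ ε

  spanning-tree : ∀ N (H : Subgraph G) → ∣ edges H ∣ < N → IsConnected H →
                  ∃ λ (T : Subgraph G) → IsTree T × vertices H ⊆ vertices T × edges T ⊆ edges H
  spanning-tree (suc N) H (s≤s ∣E∣≤N) conn with cycle? H
  ... | no acyclic = H , (conn , acyclic) , id , id
  ... | yes cyc with cycle-edge-removable conn cyc
  ...   | e , e∈ , conn′ =
    let T , tree , V⊆ , E⊆ = spanning-tree N (H -ₑ e)
          (ℕ.<-≤-trans (Sub.x∈p⇒∣p-x∣<∣p∣ e∈) ∣E∣≤N) conn′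
    in T , tree , V⊆ , Sub.p─q⊆p (edges H) ⁅ e ⁆ ∘ E⊆

  attach : (H : Subgraph G) → ∀ {e x y} → x ∈ vertices H → Joins G e x y → Subgraph G
  attach H {e} {x} {y} x∈ j = subgraph (vertices H ∪ ⁅ y ⁆) (edges H ∪ ⁅ e ⁆) λ e′∈ → closed
    (Sub.x∈p∪q⁻ (edges H) ⁅ e ⁆ e′∈)
    where
    old : vertices H ⊆ vertices H ∪ ⁅ y ⁆
    old = Sub.p⊆p∪q ⁅ y ⁆
    new : ∀ {z} → z ≡ y → z ∈ vertices H ∪ ⁅ y ⁆
    new refl = Sub.q⊆p∪q (vertices H) ⁅ y ⁆ (Sub.x∈⁅x⁆ y)
    closed : ∀ {e′} → e′ ∈ edges H ⊎ e′ ∈ ⁅ e ⁆ → source G e′ ∈ vertices H ∪ ⁅ y ⁆ ×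
        target G e′ ∈ vertices H ∪ ⁅ y ⁆
    closed (inj₁ e′∈) = let s∈ , t∈ = endpoints-∈ H e′∈ in old s∈ , old t∈
    closed (inj₂ e′∈) rewrite Sub.x∈⁅y⁆⇒x≡y e e′∈ = both j
      where
      both : Joins G e x y → source G e ∈ vertices H ∪ ⁅ y ⁆ × target G e ∈ vertices H ∪ ⁅ y ⁆
      both (inj₁ (s≡x , t≡y)) = old (subst (_∈ vertices H) (sym s≡x) x∈) , new t≡y
      both (inj₂ (s≡y , t≡x)) = new s≡y , old (subst (_∈ vertices H) (sym t≡x) x∈)

  attach-connected : ∀ (H : Subgraph G) {e x y} (x∈ : x ∈ vertices H) (j : Joins G e x y) →
      IsConnected H → IsConnected (attach H x∈ j)
  attach-connected H {e} {x} {y} x∈ j (ne , conn) = (x , Sub.p⊆p∪q ⁅ y ⁆ x∈) ,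
    λ u∈ v∈ → Star.reverse (adjacent-sym {attach H x∈ j}) (fromX u∈) ◅◅ fromX v∈
    where
    fromX : ∀ {v} → v ∈ vertices H ∪ ⁅ y ⁆ → Star (Adjacent (attach H x∈ j)) x v
    fromX v∈ with Sub.x∈p∪q⁻ (vertices H) ⁅ y ⁆ v∈
    ... | inj₁ v∈H = Star.map (λ (f , f∈ , fj) → f , Sub.p⊆p∪q ⁅ e ⁆ f∈ , fj) (conn x∈ v∈H)
    ... | inj₂ v∈y rewrite Sub.x∈⁅y⁆⇒x≡y y v∈y =
      (e , Sub.q⊆p∪q (edges H) ⁅ e ⁆ (Sub.x∈⁅x⁆ e) , j) ◅ ε

  module _ {C : Set} (col : Fin (size G) → C) (c : C) where
    open Multi {size G} {n}

    Coloured : Subgraph G → Set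
    Coloured H = ∀ {e} → e ∈ edges H → col e ≡ c

    joined⇒joins : ∀ {e u v} → Joined (ends G) e u v → Joins G e u v
    joined⇒joins (fwd refl) = inj₁ (refl , refl)
    joined⇒joins (bwd refl) = inj₂ (refl , refl)

    -- Each edge of the path starts at a vertex already present, so attaching it keeps the subgraph
    -- connected. Returning to an old vertex may close a cycle, which `spanning-tree` removes later.
    grow : ∀ H {u v} → IsConnected H → Coloured H → u ∈ vertices H → Conn (ends G) col c u v →
           ∃ λ (H′ : Subgraph G) →
             IsConnected H′ × Coloured H′ × vertices H ⊆ vertices H′ × v ∈ vertices H′
    grow H conn coloured u∈ ε = H , conn , coloured , id , u∈
    grow H {u} conn coloured u∈ (_◅_ {j = w} (via e e≡c jo) path) =
      let j = joined⇒joins jo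
          H′ , conn′ , coloured′ , V⊆ , v∈ = grow (attach H u∈ j)
            (attach-connected H u∈ j conn) coloured⁺
            (Sub.q⊆p∪q (vertices H) ⁅ w ⁆ (Sub.x∈⁅x⁆ w)) path
      in H′ , conn′ , coloured′ , V⊆ ∘ Sub.p⊆p∪q ⁅ w ⁆ , v∈
      where
      coloured⁺ : ∀ {f} → f ∈ edges H ∪ ⁅ e ⁆ → col f ≡ c
      coloured⁺ f∈ with Sub.x∈p∪q⁻ (edges H) ⁅ e ⁆ f∈
      ... | inj₁ f∈H = coloured f∈H
      ... | inj₂ f∈e = trans (cong col (Sub.x∈⁅y⁆⇒x≡y e f∈e)) e≡c

    point : Fin n → Subgraph G
    point u = subgraph ⁅ u ⁆ ⊥ λ e∈ → contradiction e∈ Sub.∉⊥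

    point-connected : ∀ u → IsConnected (point u)
    point-connected u = (u , Sub.x∈⁅x⁆ u) , λ a∈ b∈ →
      subst₂ (Star (Adjacent (point u))) (sym (Sub.x∈⁅y⁆⇒x≡y u a∈)) (sym (Sub.x∈⁅y⁆⇒x≡y u b∈)) ε

    colour-tree : (τ : Fin 3 → Fin n) → (∀ i j → Conn (ends G) col c (τ i) (τ j)) →
                  ∃ λ (T : Subgraph G) → IsTree T × (∀ i → τ i ∈ vertices T) × Coloured T
    colour-tree τ conn =
      let u = τ zero
          H₁ , conn₁ , col₁ , V₁ , b∈ = grow (point u) (point-connected u)
            (λ e∈ → contradiction e∈ Sub.∉⊥) (Sub.x∈⁅x⁆ u) (conn zero (suc zero))
          H₂ , conn₂ , col₂ , V₂ , c∈ = grow H₁ conn₁ col₁ (V₁ (Sub.x∈⁅x⁆ u))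
            (conn zero (suc (suc zero)))
          T , tree , V , E = spanning-tree (suc ∣ edges H₂ ∣) H₂ ℕ.≤-refl conn₂
      in T , tree , (λ { zero → V (V₂ (V₁ (Sub.x∈⁅x⁆ u))) ; (suc zero) → V (V₂ b∈) ;
        (suc (suc zero)) → V c∈ }) , col₂ ∘ E

module _ {n} (G : Graph n) where
  open Multi {size G} {n}

  tree-packing : ∀ {S k} (τ : Fin 3 → Fin n) (inj : ∀ {i j} → τ i ≡ τ j → i ≡ j) →
      (∀ {x} → x ∈ S → ∃ λ i → τ i ≡ x) →
                 Packings.Packing {size G} {n} τ inj (ends G) k → TreePacking G S k
  tree-packing {S} {k} τ inj onto p = record
    { tree     = proj₁ ∘ T
    ; isTree   = proj₁ ∘ proj₂ ∘ T
    ; connects = λ i x∈ → let j , eq = onto x∈ in subst (_∈ vertices (proj₁ (T i))) eq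
      (proj₁ (proj₂ (proj₂ (T i))) j)
    ; disjoint = λ {i} {j} i≢j (e , e∈) → let e∈i , e∈j = Sub.x∈p∩q⁻ _ _ e∈ in
        i≢j (Fin.toℕ-injective (trans (sym (proj₂ (proj₂ (proj₂ (T i))) e∈i))
          (proj₂ (proj₂ (proj₂ (T j))) e∈j)))
    }
    where
    open Packings.Packing p
    T : ∀ i → ∃ λ (T : Subgraph G) → IsTree T × (∀ j → τ j ∈ vertices T) ×
        Coloured colour (Fin.toℕ i) T
    T i = colour-tree colour (Fin.toℕ i) τ (connected (Fin.toℕ<n i))

  λ₃-lower : ∀ (n≥3 : 3 ≤ n) k → 4 * k ≤ suc (3 * edgeConnectivity G (ℕ.<⇒≤ n≥3)) → k ≤ λ₃ G n≥3
  λ₃-lower n≥3 k le = go (Minimum.attained (minimumTripleConnectivity G n≥3))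
    where
    go : TripleConnectivity G (λ₃ G n≥3) → k ≤ λ₃ G n≥3
    go (S , ∣S∣≡3 , eq) = subst (k ≤_) eq (Maximum.greatest (maximumTreePacking G S _)
      (three ∣S∣≡3 (enumerate S)))
      where
      three : ∀ {s} → s ≡ 3 → Enumeration S s → TreePacking G S k
      three refl record { element = τ ; injective = inj ; onto = onto } =
        tree-packing τ inj onto (Packings.pack τ inj (suc (innerSize (ends G) (const true)))
          (ends G) _ k ℕ.≤-refl le cond)
        where
        -- An isolating set contains its own terminal and misses another one, so it defines a proper
        -- edge cut.
        cond : Packings.CutCondition τ inj (ends G) (edgeConnectivity G (ℕ.<⇒≤ n≥3))
        cond zero             X iso = edgeConnectivity≤cut G (ℕ.<⇒≤ n≥3) X (iso zero)
          (iso (suc zero))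
        cond (suc zero)       X iso = edgeConnectivity≤cut G (ℕ.<⇒≤ n≥3) X (iso (suc zero))
          (iso zero)
        cond (suc (suc zero)) X iso = edgeConnectivity≤cut G (ℕ.<⇒≤ n≥3) X (iso (suc (suc zero)))
          (iso zero)

-- Extremal graphs

injective⇒≤-covered : ∀ {k N m} (g : Fin k → Fin m) → (∀ {i j} → g i ≡ g j → i ≡ j) →
                      (h : Fin N → Fin m) → (∀ i → ∃ λ t → h t ≡ g i) → k ≤ N
injective⇒≤-covered g g-inj h cover = Fin.injective⇒≤ {f = proj₁ ∘ cover} λ {i} {j} eq →
  g-inj (trans (sym (proj₂ (cover i))) (trans (cong h eq) (proj₂ (cover j))))

covered⇒∣S∣≤ : ∀ {N m} {S : Subset m} (h : Fin N → Fin m) → (∀ {x} → x ∈ S → ∃ λ t → h t ≡ x) →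
    ∣ S ∣ ≤ N
covered⇒∣S∣≤ {S = S} h cover = injective⇒≤-covered element injective h (cover ∘ member)
  where open Enumeration (enumerate S)

injective⇒≤∣S∣ : ∀ {k m} {S : Subset m} (g : Fin k → Fin m) → (∀ {i j} → g i ≡ g j → i ≡ j) →
                 (∀ i → g i ∈ S) → k ≤ ∣ S ∣
injective⇒≤∣S∣ {S = S} g g-inj g∈ = injective⇒≤-covered g g-inj element (onto ∘ g∈)
  where open Enumeration (enumerate S)

-- The constructive frame of the counting below: either some route survives, or all are blocked and
-- the blocking edges are collected in a function.
some-or-all : ∀ {k} {A : Set} {B : Fin k → Set} → (∀ i → A ⊎ B i) → A ⊎ (∀ i → B i)
some-or-all {zero}  f = inj₂ λ ()
some-or-all {suc k} f with f zero | some-or-all (f ∘ suc)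
... | inj₁ a | _       = inj₁ a
... | inj₂ _ | inj₁ a  = inj₁ a
... | inj₂ b | inj₂ bs = inj₂ λ { zero → b ; (suc i) → bs i }

module _ {n} {Adj : Fin n → Fin n → Set} (Adj? : ∀ u v → Dec (Adj u v)) where

  private
    Edge : Fin (n * n) → Set
    Edge x = proj₁ (Fin.remQuot {n} n x) Fin.< proj₂ (Fin.remQuot {n} n x) ×
             Adj (proj₁ (Fin.remQuot {n} n x)) (proj₂ (Fin.remQuot {n} n x))

    edge? : ∀ x → Dec (Edge x)
    edge? x = (_ Fin.<? _) ×-dec Adj? _ _

    pairs : Subset (n * n)
    pairs = tabulate λ x → does (edge? x)

    open Enumeration (enumerate pairs)

  -- Only pairs with `u < v` are kept, so the relation may be reflexive, as membership in the same
  -- clique is.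
  graphOf : Graph n
  graphOf = record
    { size          = ∣ pairs ∣
    ; source        = λ e → proj₁ (Fin.remQuot {n} n (element e))
    ; target        = λ e → proj₂ (Fin.remQuot {n} n (element e))
    ; source<target = λ e → proj₁ (does⁻ (edge? (element e)) (∈-tabulate⁻ (member e)))
    ; distinct      = λ {e} {f} s t → injective (trans (sym (Fin.combine-remQuot {n} n (element e)))
                        (trans (cong₂ Fin.combine s t) (Fin.combine-remQuot {n} n (element f))))
    }

  graphOf-sound : ∀ e → Adj (source graphOf e) (target graphOf e)
  graphOf-sound e = proj₂ (does⁻ (edge? (element e)) (∈-tabulate⁻ (member e)))

  graphOf-complete : ∀ {u v} → u Fin.< v → Adj u v → ∃ λ e → source graphOf e ≡ u ×
      target graphOf e ≡ v
  graphOf-complete {u} {v} u<v uv =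
    let e , eq = onto (∈-tabulate⁺ (dec-true (edge? (Fin.combine u v)) edge))
        split  = trans (cong (Fin.remQuot {n} n) eq) (Fin.remQuot-combine u v)
    in e , cong proj₁ split , cong proj₂ split
    where
    edge : Edge (Fin.combine u v)
    edge = subst (λ (u , v) → u Fin.< v × Adj u v) (sym (Fin.remQuot-combine u v)) (u<v , uv)

module _ {n} (G : Graph n) where

  joins-ends : ∀ {e u v u′ v′} → Joins G e u v → Joins G e u′ v′ →
      (u ≡ u′ × v ≡ v′) ⊎ (u ≡ v′ × v ≡ u′)
  joins-ends (inj₁ (refl , refl)) (inj₁ (refl , refl)) = inj₁ (refl , refl)
  joins-ends (inj₁ (refl , refl)) (inj₂ (refl , refl)) = inj₂ (refl , refl)
  joins-ends (inj₂ (refl , refl)) (inj₁ (refl , refl)) = inj₂ (refl , refl)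
  joins-ends (inj₂ (refl , refl)) (inj₂ (refl , refl)) = inj₁ (refl , refl)

  joins-simple : ∀ {e f u v} → Joins G e u v → Joins G f u v → e ≡ f
  joins-simple (inj₁ (s , t)) (inj₁ (s′ , t′)) = distinct G (trans s (sym s′)) (trans t (sym t′))
  joins-simple (inj₂ (s , t)) (inj₂ (s′ , t′)) = distinct G (trans s (sym s′)) (trans t (sym t′))
  joins-simple {e} {f} (inj₁ (refl , refl)) (inj₂ (s′ , t′)) =
    contradiction (source<target G e) (ℕ.<-asym (subst₂ Fin._<_ s′ t′ (source<target G f)))
  joins-simple {e} {f} (inj₂ (refl , refl)) (inj₁ (s′ , t′)) =
    contradiction (source<target G e) (ℕ.<-asym (subst₂ Fin._<_ s′ t′ (source<target G f)))

-- Three cliques 0, 1, 2 of A + B + 1 vertices each, with A disjoint edges ("strands")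
-- between 0 and 1, and B from each of 0 and 1 to 2.
module ThreeCliques (A B : ℕ) (A≤B : A ≤ B) where

  -- A vertex then has A + B others in its clique, which keeps the clique linked after deletion of
  -- fewer than A + B edges.
  M n : ℕ
  M = suc (A + B)
  n = M * 3

  opaque
    vertex : Fin M → Fin 3 → Fin n
    vertex = Fin.combine

    index : Fin n → Fin M
    index v = proj₁ (Fin.remQuot {M} 3 v)

    part : Fin n → Fin 3
    part v = proj₂ (Fin.remQuot {M} 3 v)

    part-vertex : ∀ i p → part (vertex i p) ≡ p
    part-vertex i p = cong proj₂ (Fin.remQuot-combine i p)

    index-vertex : ∀ i p → index (vertex i p) ≡ i
    index-vertex i p = cong proj₁ (Fin.remQuot-combine i p)

  vertex-injectiveˡ : ∀ {i p j q} → vertex i p ≡ vertex j q → i ≡ j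
  vertex-injectiveˡ eq = trans (sym (index-vertex _ _)) (trans (cong index eq) (index-vertex _ _))

  vertex-injectiveʳ : ∀ {i p j q} → vertex i p ≡ vertex j q → p ≡ q
  vertex-injectiveʳ eq = trans (sym (part-vertex _ _)) (trans (cong part eq) (part-vertex _ _))

  Strand : Set
  Strand = Fin A ⊎ Fin B ⊎ Fin B

  A≤M : A ≤ M
  A≤M = ℕ.≤-trans (ℕ.m≤m+n A B) (ℕ.n≤1+n _)

  B≤M : B ≤ M
  B≤M = ℕ.≤-trans (ℕ.m≤n+m B A) (ℕ.n≤1+n _)

  lo hi : Strand → Fin n
  lo (inj₁ i)        = vertex (Fin.inject≤ i A≤M) zero
  lo (inj₂ (inj₁ i)) = vertex (Fin.inject≤ i B≤M) zero
  lo (inj₂ (inj₂ i)) = vertex (Fin.inject≤ i B≤M) (suc zero)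
  hi (inj₁ i)        = vertex (Fin.inject≤ i A≤M) (suc zero)
  hi (inj₂ (inj₁ i)) = vertex (Fin.inject≤ i B≤M) (suc (suc zero))
  hi (inj₂ (inj₂ i)) = vertex (Fin.inject≤ i B≤M) (suc (suc zero))

  anyStrand? : ∀ {P : Strand → Set} → (∀ σ → Dec (P σ)) → Dec (∃ P)
  anyStrand? P? = map′
    (λ { (inj₁ (i , p)) → _ , p ; (inj₂ (inj₁ (i , p))) → _ , p ; (inj₂ (inj₂ (i , p))) → _ , p })
    (λ { (inj₁ i , p) → inj₁ (i , p) ; (inj₂ (inj₁ i) , p) → inj₂ (inj₁ (i , p)) ;
      (inj₂ (inj₂ i) , p) → inj₂ (inj₂ (i , p)) })
    (Fin.any? (P? ∘ inj₁) ⊎-dec (Fin.any? (P? ∘ inj₂ ∘ inj₁) ⊎-dec Fin.any? (P? ∘ inj₂ ∘ inj₂)))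

  part-lo<part-hi : ∀ σ → part (lo σ) Fin.< part (hi σ)
  part-lo<part-hi (inj₁ i)        rewrite part-vertex (Fin.inject≤ i A≤M) zero | part-vertex
    (Fin.inject≤ i A≤M) (suc zero) = s≤s z≤n
  part-lo<part-hi (inj₂ (inj₁ i)) rewrite part-vertex (Fin.inject≤ i B≤M) zero | part-vertex
    (Fin.inject≤ i B≤M) (suc (suc zero)) = s≤s z≤n
  part-lo<part-hi (inj₂ (inj₂ i)) rewrite part-vertex (Fin.inject≤ i B≤M) (suc zero) | part-vertex
    (Fin.inject≤ i B≤M) (suc (suc zero)) = s≤s (s≤s z≤n)

  strand-unique : ∀ σ ρ → lo σ ≡ lo ρ → hi σ ≡ hi ρ → σ ≡ ρ
  strand-unique (inj₁ i)        (inj₁ j)        l h = cong inj₁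
    (Fin.inject≤-injective A≤M A≤M i j (vertex-injectiveˡ l))
  strand-unique (inj₂ (inj₁ i)) (inj₂ (inj₁ j)) l h = cong (inj₂ ∘ inj₁)
    (Fin.inject≤-injective B≤M B≤M i j (vertex-injectiveˡ l))
  strand-unique (inj₂ (inj₂ i)) (inj₂ (inj₂ j)) l h = cong (inj₂ ∘ inj₂)
    (Fin.inject≤-injective B≤M B≤M i j (vertex-injectiveˡ l))
  strand-unique (inj₁ i)        (inj₂ (inj₁ j)) l h with () ← vertex-injectiveʳ h
  strand-unique (inj₁ i)        (inj₂ (inj₂ j)) l h with () ← vertex-injectiveʳ h
  strand-unique (inj₂ (inj₁ i)) (inj₁ j)        l h with () ← vertex-injectiveʳ h
  strand-unique (inj₂ (inj₁ i)) (inj₂ (inj₂ j)) l h with () ← vertex-injectiveʳ l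
  strand-unique (inj₂ (inj₂ i)) (inj₁ j)        l h with () ← vertex-injectiveʳ h
  strand-unique (inj₂ (inj₂ i)) (inj₂ (inj₁ j)) l h with () ← vertex-injectiveʳ l

  Adj : Fin n → Fin n → Set
  Adj u v = part u ≡ part v ⊎ ∃ λ σ → (lo σ ≡ u × hi σ ≡ v) ⊎ (lo σ ≡ v × hi σ ≡ u)

  Adj? : ∀ u v → Dec (Adj u v)
  Adj? u v = (part u Fin.≟ part v) ⊎-dec anyStrand? λ σ →
    ((lo σ Fin.≟ u) ×-dec (hi σ Fin.≟ v)) ⊎-dec ((lo σ Fin.≟ v) ×-dec (hi σ Fin.≟ u))

  Adj-sym : ∀ {u v} → Adj u v → Adj v u
  Adj-sym (inj₁ eq)            = inj₁ (sym eq)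
  Adj-sym (inj₂ (σ , inj₁ eq)) = inj₂ (σ , inj₂ eq)
  Adj-sym (inj₂ (σ , inj₂ eq)) = inj₂ (σ , inj₁ eq)

  module Realised (G : Graph n) (sound : ∀ e → Adj (source G e) (target G e))
    (complete : ∀ {u v} → u Fin.< v → Adj u v → ∃ λ e → source G e ≡ u × target G e ≡ v) where

    edge : ∀ {u v} → u ≢ v → Adj u v → ∃ λ e → Joins G e u v
    edge {u} {v} u≢v uv with Fin.<-cmp u v
    ... | tri< u<v _ _ = let e , eq = complete u<v uv in e , inj₁ eq
    ... | tri≈ _ u≡v _ = contradiction u≡v u≢v
    ... | tri> _ _ v<u = let e , eq = complete v<u (Adj-sym uv) in e , inj₂ eq

    strand : ∀ σ → ∃ λ e → Joins G e (lo σ) (hi σ)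
    strand σ = edge (λ eq → ℕ.<-irrefl (cong (Fin.toℕ ∘ part) eq) (part-lo<part-hi σ))
      (inj₂ (σ , inj₁ (refl , refl)))

    strandEdge : Strand → Fin (size G)
    strandEdge = proj₁ ∘ strand

    strandEdge-injective : ∀ {σ ρ} → strandEdge σ ≡ strandEdge ρ → σ ≡ ρ
    strandEdge-injective {σ} {ρ} eq with joins-ends G (proj₂ (strand σ))
      (subst (λ e → Joins G e (lo ρ) (hi ρ)) (sym eq) (proj₂ (strand ρ)))
    ... | inj₁ (l , h) = strand-unique σ ρ l h
    ... | inj₂ (l , h) = contradiction (part-lo<part-hi ρ)
      (ℕ.<-asym (subst₂ (λ u v → part u Fin.< part v) l h (part-lo<part-hi σ)))

    crossing⇒strand : ∀ {e u v} → Joins G e u v → part u ≢ part v → ∃ λ σ → strandEdge σ ≡ e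
    crossing⇒strand {e} {u} {v} j ≢ = go j (sound e)
      where
      go : Joins G e u v → Adj (source G e) (target G e) → ∃ λ σ → strandEdge σ ≡ e
      go (inj₁ (refl , refl)) (inj₁ eq) = contradiction eq ≢
      go (inj₂ (refl , refl)) (inj₁ eq) = contradiction (sym eq) ≢
      go _ (inj₂ (σ , inj₁ (l , h))) = σ , joins-simple G (proj₂ (strand σ)) (inj₁ (sym l , sym h))
      go _ (inj₂ (σ , inj₂ (l , h))) = σ , joins-simple G (proj₂ (strand σ)) (inj₂ (sym h , sym l))

    -- Edge-connectivity of the three-clique graph

    module Surviving (F : Subset (size G)) (∣F∣<ℓ : ∣ F ∣ < A + B) where

      Path : Fin n → Fin n → Set
      Path = Star (Adjacent (deleteEdges G F))

      path-sym : ∀ {u v} → Path u v → Path v u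
      path-sym = Star.reverse (adjacent-sym {H = deleteEdges G F})

      step : ∀ {e u v} → e ∉ F → Joins G e u v → Path u v
      step e∉ j = (_ , Sub.x∉p⇒x∈∁p e∉ , j) ◅ ε

      -- The A + B other members `w` of the clique give edge-disjoint routes u, w, v, with w = v as
      -- the direct edge. If all were blocked, one blocking edge per route would give A + B distinct
      -- elements of `F`.
      within : ∀ {u v} → part u ≡ part v → Path u v
      within {u} {v} u~v with u Fin.≟ v
      ... | yes refl = ε
      ... | no u≢v   = [ id , (λ blocked → contradiction
        (injective⇒≤∣S∣ (proj₁ ∘ blocked) (inj blocked) (λ i → proj₁ (proj₂ (blocked i))))
        (ℕ.<⇒≱ ∣F∣<ℓ)) ] (some-or-all via-w)
        where
        w : Fin (A + B) → Fin n
        w i = vertex (Fin.punchIn (index u) i) (part u)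
        part-w : ∀ i → part (w i) ≡ part u
        part-w i = part-vertex _ _
        u≢w : ∀ i → u ≢ w i
        u≢w i eq = Fin.punchInᵢ≢i (index u) i (trans (sym (index-vertex _ _)) (cong index (sym eq)))
        w-injective : ∀ {i j} → w i ≡ w j → i ≡ j
        w-injective {i} {j} eq = Fin.punchIn-injective (index u) i j (vertex-injectiveˡ eq)
        Blocked : Fin (A + B) → Set
        Blocked i = ∃ λ e → e ∈ F × (Joins G e u (w i) ⊎ Joins G e v (w i))
        via-w : ∀ i → Path u v ⊎ Blocked i
        via-w i with edge (u≢w i) (inj₁ (sym (part-w i)))
        ... | e , j with e Sub.∈? F | v Fin.≟ w i
        ...   | yes e∈ | _        = inj₂ (e , e∈ , inj₁ j)
        ...   | no e∉  | yes refl = inj₁ (step e∉ j)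
        ...   | no e∉  | no v≢w   with edge v≢w (inj₁ (trans (sym u~v) (sym (part-w i))))
        ...     | f , j′ with f Sub.∈? F
        ...       | yes f∈ = inj₂ (f , f∈ , inj₂ j′)
        ...       | no f∉  = inj₁ (step e∉ j ◅◅ step f∉ (joins-sym {G = G} j′))
        inj : (blocked : ∀ i → Blocked i) → ∀ {i j} → proj₁ (blocked i) ≡ proj₁ (blocked j) → i ≡ j
        inj blocked {i} {j} eq = same (proj₂ (proj₂ (blocked i))) (proj₂ (proj₂ (blocked j))) eq
          where
          same : ∀ {e f} → Joins G e u (w i) ⊎ Joins G e v (w i) →
              Joins G f u (w j) ⊎ Joins G f v (w j) → e ≡ f → i ≡ j
          same (inj₁ p) (inj₁ q) refl with joins-ends G p q
          ... | inj₁ (_ , eq) = w-injective eq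
          ... | inj₂ (eq , _) = contradiction eq (u≢w j)
          same (inj₂ p) (inj₂ q) refl with joins-ends G p q
          ... | inj₁ (_ , eq) = w-injective eq
          ... | inj₂ (eq , eq′) = w-injective (trans eq′ eq)
          same (inj₁ p) (inj₂ q) refl with joins-ends G p q
          ... | inj₁ (_ , eq) = w-injective eq
          ... | inj₂ (eq , _) = contradiction eq (u≢w j)
          same (inj₂ p) (inj₁ q) refl with joins-ends G p q
          ... | inj₁ (_ , eq) = w-injective eq
          ... | inj₂ (_ , eq) = contradiction (sym eq) (u≢w i)

      PartsLinked : Fin 3 → Fin 3 → Set
      PartsLinked p q = ∀ {u v} → part u ≡ p → part v ≡ q → Path u v

      linked-sym : ∀ {p q} → PartsLinked p q → PartsLinked q p
      linked-sym l u∈ v∈ = path-sym (l v∈ u∈)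

      linked-trans : ∀ {p q r} → PartsLinked p q → PartsLinked q r → PartsLinked p r
      linked-trans {q = q} l l′ u∈ v∈ = l u∈ (part-vertex zero q) ◅◅ l′ (part-vertex zero q) v∈

      linked : ∀ {u v} → Path u v → PartsLinked (part u) (part v)
      linked path u′ v′ = within u′ ◅◅ path ◅◅ within (sym v′)

      -- At least A + B strands end in clique `p`, listed in two families by `strandAt`, so one of
      -- them is not in `F`.
      leave : ∀ p {a b} (strandAt : Fin a ⊎ Fin b → Strand) →
          (∀ {x y} → strandAt x ≡ strandAt y → x ≡ y) → A + B ≤ a + b →
              (∀ x → part (lo (strandAt x)) ≡ p ⊎ part (hi (strandAt x)) ≡ p) → ∃ λ q →
                q ≢ p × PartsLinked p q
      leave p {a} {b} strandAt inj ℓ≤ touches =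
        [ id , (λ all∈ → contradiction (ℕ.≤-trans ℓ≤
          (injective⇒≤∣S∣ (strandEdge ∘ σ) (σ-injective ∘ strandEdge-injective) all∈))
          (ℕ.<⇒≱ ∣F∣<ℓ)) ]
          (some-or-all survives)
        where
        σ : Fin (a + b) → Strand
        σ t = strandAt (Fin.splitAt a t)
        σ-injective : ∀ {t t′} → σ t ≡ σ t′ → t ≡ t′
        σ-injective {t} {t′} eq = trans (sym (Fin.join-splitAt a b t))
          (trans (cong (Fin.join a b) (inj eq)) (Fin.join-splitAt a b t′))
        survives : ∀ t → (∃ λ q → q ≢ p × PartsLinked p q) ⊎ strandEdge (σ t) ∈ F
        survives t with strandEdge (σ t) Sub.∈? F
        ... | yes e∈ = inj₂ e∈
        ... | no e∉  = inj₁ (from (touches (Fin.splitAt a t)))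
          where
          lo~hi : PartsLinked (part (lo (σ t))) (part (hi (σ t)))
          lo~hi = linked (step e∉ (proj₂ (strand (σ t))))
          lo≢hi : part (lo (σ t)) ≢ part (hi (σ t))
          lo≢hi = Fin.<⇒≢ (part-lo<part-hi (σ t))
          from : part (lo (σ t)) ≡ p ⊎ part (hi (σ t)) ≡ p → ∃ λ q → q ≢ p × PartsLinked p q
          from (inj₁ eq) = part (hi (σ t)) , (λ hi≡p → lo≢hi (trans eq (sym hi≡p))) , subst
            (λ p → PartsLinked p (part (hi (σ t)))) eq lo~hi
          from (inj₂ eq) = part (lo (σ t)) , (λ lo≡p → lo≢hi (trans lo≡p (sym eq))) , subst
            (λ p → PartsLinked p (part (lo (σ t)))) eq (linked-sym lo~hi)

      leave-any : ∀ p → ∃ λ q → q ≢ p × PartsLinked p q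
      leave-any zero = leave zero {A} {B} [ inj₁ , inj₂ ∘ inj₁ ]
        (λ { {inj₁ _} {inj₁ _} refl → refl ; {inj₂ _} {inj₂ _} refl → refl }) ℕ.≤-refl
        λ { (inj₁ i) → inj₁ (part-vertex _ _) ; (inj₂ i) → inj₁ (part-vertex _ _) }
      leave-any (suc zero) = leave (suc zero) {A} {B} [ inj₁ , inj₂ ∘ inj₂ ]
        (λ { {inj₁ _} {inj₁ _} refl → refl ; {inj₂ _} {inj₂ _} refl → refl }) ℕ.≤-refl
        λ { (inj₁ i) → inj₂ (part-vertex _ _) ; (inj₂ i) → inj₁ (part-vertex _ _) }
      -- Clique 2 has 2B strands, which is enough because `A ≤ B`.
      leave-any (suc (suc zero)) = leave (suc (suc zero)) {B} {B} inj₂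
        (λ { refl → refl }) (ℕ.+-monoˡ-≤ B A≤B)
        λ { (inj₁ i) → inj₂ (part-vertex _ _) ; (inj₂ i) → inj₂ (part-vertex _ _) }

      -- Every clique is linked to another one, and a graph on three points without isolated points
      -- is connected.
      all-linked : ∀ p → PartsLinked p zero
      all-linked zero u∈ v∈ = within (trans u∈ (sym v∈))
      all-linked (suc zero) with leave-any (suc zero) | leave-any zero | leave-any (suc (suc zero))
      ... | zero , _ , l           | _                          | _ = l
      ... | suc zero , ≢ , _       | _                          | _ = contradiction refl ≢
      ... | suc (suc zero) , _ , _ | zero , ≢ , _               | _ = contradiction refl ≢
      ... | suc (suc zero) , _ , _ | suc zero , _ , l           | _ = linked-sym l
      ... | suc (suc zero) , _ , l | suc (suc zero) , _ , l′    | _ = linked-trans l (linked-sym l′)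
      all-linked (suc (suc zero)) with leave-any (suc (suc zero)) | leave-any zero
      ... | zero , _ , l           | _                          = l
      ... | suc (suc zero) , ≢ , _ | _                          = contradiction refl ≢
      ... | suc zero , _ , _       | zero , ≢ , _               = contradiction refl ≢
      ... | suc zero , _ , _       | suc (suc zero) , _ , l     = linked-sym l
      ... | suc zero , _ , l       | suc zero , _ , l′          = linked-trans l (linked-sym l′)

      path : ∀ u v → Path u v
      path u v = all-linked (part u) refl (part-vertex zero zero) ◅◅ path-sym
        (all-linked (part v) refl (part-vertex zero zero))

      connected : IsConnected (deleteEdges G F)
      connected = (vertex zero zero , Sub.∈⊤) , λ {u} {v} _ _ → path u v

    isConnected : 1 ≤ A + B → Connected G
    isConnected 1≤ℓ = (vertex zero zero , Sub.∈⊤) , λ {u} {v} _ _ →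
      Star.map (λ (e , _ , j) → e , Sub.∈⊤ , j)
        (Surviving.path ⊥ (subst (_< A + B) (sym (Sub.∣⊥∣≡0 (size G))) 1≤ℓ) u v)

    edgeConnectivity≥ : ∀ .(2≤n : 2 ≤ n) → A + B ≤ edgeConnectivity G 2≤n
    edgeConnectivity≥ 2≤n = go (Minimum.attained (minimumDisconnectingSize G 2≤n))
      where
      go : DisconnectingSize G (edgeConnectivity G 2≤n) → A + B ≤ edgeConnectivity G 2≤n
      go (F , ¬conn , eq) = subst (A + B ≤_) eq (ℕ.≮⇒≥ λ lt → ¬conn (Surviving.connected F lt))

    module Cuts = Multi {size G} {n}

    -- The cut around clique 0 consists of its A + B strands.
    edgeConnectivity≤ : ∀ .(2≤n : 2 ≤ n) → edgeConnectivity G 2≤n ≤ A + B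
    edgeConnectivity≤ 2≤n = ℕ.≤-trans
      (edgeConnectivity≤cut G 2≤n X {vertex zero zero} {vertex zero (suc zero)}
        (X-part _ (part-vertex _ _)) X1)
      (ℕ.≤-trans (ℕ.≤-reflexive (sym (∣tabulate∣≡sum (Cuts.cross (ends G) X))))
        (covered⇒∣S∣≤ {A + B} (strandEdge ∘ at0 ∘ Fin.splitAt A) (covered ∘ ∈-tabulate⁻)))
      where
      X : Fin n → Bool
      X v = does (part v Fin.≟ zero)
      X-part : ∀ v → part v ≡ zero → X v ≡ true
      X-part v eq = dec-true (part v Fin.≟ zero) eq
      X-part′ : ∀ v → part v ≢ zero → X v ≡ false
      X-part′ v = dec-false (part v Fin.≟ zero)
      X1 : X (vertex zero (suc zero)) ≡ false
      X1 = X-part′ (vertex zero (suc zero)) λ eq → contradiction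
        (trans (sym (part-vertex zero (suc zero))) eq) λ ()
      at0 : Fin A ⊎ Fin B → Strand
      at0 = [ inj₁ , inj₂ ∘ inj₁ ]
      covered : ∀ {e} → Cuts.cross (ends G) X e ≡ true → ∃ λ t →
          strandEdge (at0 (Fin.splitAt A t)) ≡ e
      covered {e} c with part (source G e) Fin.≟ part (target G e)
      ... | yes eq = contradiction (trans (sym c)
        (trans (cong (λ p → does (p Fin.≟ zero) xor X (target G e)) eq)
        (Bool.xor-same (X (target G e))))) λ ()
      ... | no ≢ with crossing⇒strand (inj₁ (refl , refl)) ≢
      ...   | inj₁ i , eq        = Fin.join A B (inj₁ i) , trans
        (cong (strandEdge ∘ at0) (Fin.splitAt-join A B (inj₁ i))) eq
      ...   | inj₂ (inj₁ i) , eq = Fin.join A B (inj₂ i) , trans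
        (cong (strandEdge ∘ at0) (Fin.splitAt-join A B (inj₂ i))) eq
      ...   | σ@(inj₂ (inj₂ i)) , eq = contradiction
        (trans (sym c) (uncrossed (subst (λ e → Joins G e (lo σ) (hi σ)) eq (proj₂ (strand σ)))))
        λ ()
        where
        outside-lo : X (lo σ) ≡ false
        outside-lo = X-part′ (lo σ) λ eq → contradiction (trans (sym (part-vertex _ _)) eq) λ ()
        outside-hi : X (hi σ) ≡ false
        outside-hi = X-part′ (hi σ) λ eq → contradiction (trans (sym (part-vertex _ _)) eq) λ ()
        uncrossed : Joins G e (lo σ) (hi σ) → Cuts.cross (ends G) X e ≡ false
        uncrossed (inj₁ (s , t)) = cong₂ _xor_ (trans (cong X s) outside-lo)
          (trans (cong X t) outside-hi)
        uncrossed (inj₂ (s , t)) = cong₂ _xor_ (trans (cong X s) outside-hi)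
          (trans (cong X t) outside-lo)

    -- Trees meeting all three cliques

    firstExit : ∀ {R : Fin n → Fin n → Set} {p u v} → Star R u v → part u ≡ p → part v ≢ p →
                ∃₂ λ x y → R x y × part x ≡ p × part y ≢ p
    firstExit ε u∈ v∉ = contradiction u∈ v∉
    firstExit {p = p} (_◅_ {i = u} {j = w} r path) u∈ v∉ with part w Fin.≟ p
    ... | yes w∈ = firstExit path w∈ v∉
    ... | no w∉  = u , w , r , u∈ , w∉

    -- Since `Fin.combine zero p` is the element at position `p`, the first three elements of
    -- `Fin n` are one vertex from each clique.
    Transversal : Subset n
    Transversal = inside Vec.∷ inside Vec.∷ inside Vec.∷ ⊥

    opaque
      unfolding vertex

      vertex∈Transversal : ∀ p → vertex zero p ∈ Transversal
      vertex∈Transversal zero             = Vec.here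
      vertex∈Transversal (suc zero)       = Vec.there Vec.here
      vertex∈Transversal (suc (suc zero)) = Vec.there (Vec.there Vec.here)

    ∣Transversal∣≡3 : ∣ Transversal ∣ ≡ 3
    ∣Transversal∣≡3 = cong (3 +_) (Sub.∣⊥∣≡0 ((A + B) * 3))

    -- A strand of the tree leaves clique 0. If it enters clique 1, it misses clique 2, and a strand
    -- leaving clique 2 is a different one; otherwise it misses clique 1, and a strand leaving
    -- clique 1 is a different one.
    two-strands : ∀ {T : Subgraph G} → IsTree T → Transversal ⊆ vertices T →
                  ∃₂ λ σ ρ → σ ≢ ρ × strandEdge σ ∈ edges T × strandEdge ρ ∈ edges T
    two-strands {T} ((_ , conn) , _) S⊆ = first (exit zero (suc zero) (λ ()))
      where
      Exit : Fin 3 → Set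
      Exit p = ∃₂ λ x y → Adjacent T x y × part x ≡ p × part y ≢ p
      exit : ∀ p q → q ≢ p → Exit p
      exit p q q≢p = firstExit (conn (S⊆ (vertex∈Transversal p)) (S⊆ (vertex∈Transversal q)))
        (part-vertex zero p) (q≢p ∘ trans (sym (part-vertex zero q)))
      exit-strand : ∀ {p} ((x , y , (e , _) , _) : Exit p) → ∃ λ σ → strandEdge σ ≡ e
      exit-strand (x , y , (e , _ , j) , x∈ , y∉) = crossing⇒strand j λ eq → y∉ (trans (sym eq) x∈)
      combine : ∀ {p q} → p ≢ q → ((x , y , _) : Exit p) → part y ≢ q → Exit q →
                ∃₂ λ σ ρ → σ ≢ ρ × strandEdge σ ∈ edges T × strandEdge ρ ∈ edges T
      combine p≢q ex@(x , y , (e , e∈ , j) , x∈ , _) y∉ ex′@(x′ , y′ , (e′ , e′∈ , j′) , x′∈ , _) =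
        let σ , σ≡ = exit-strand ex
            ρ , ρ≡ = exit-strand ex′
        in σ , ρ , (λ σ≡ρ → differ j j′ (trans (sym σ≡) (trans (cong strandEdge σ≡ρ) ρ≡)))
             , subst (_∈ edges T) (sym σ≡) e∈ , subst (_∈ edges T) (sym ρ≡) e′∈
        where
        differ : ∀ {e e′} → Joins G e x y → Joins G e′ x′ y′ → e ≢ e′
        differ j j′ refl with joins-ends G j j′
        ... | inj₁ (eq , _) = p≢q (trans (sym x∈) (trans (cong part eq) x′∈))
        ... | inj₂ (_ , eq) = y∉ (trans (cong part eq) x′∈)
      first : Exit zero → ∃₂ λ σ ρ → σ ≢ ρ × strandEdge σ ∈ edges T × strandEdge ρ ∈ edges T
      first ex@(x , y , _ , _ , y∉) with part y Fin.≟ suc zero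
      ... | yes y∈1 = combine (λ ()) ex (λ eq → contradiction (trans (sym y∈1) eq) λ ())
        (exit (suc (suc zero)) zero (λ ()))
      ... | no  y∉1 = combine (λ ()) ex y∉1 (exit (suc zero) zero (λ ()))

    -- Each tree uses two strands, edge-disjoint trees use different ones, and there are A + 2B in
    -- all.
    transversal-packing-bound : ∀ {k} → TreePacking G Transversal k → k * 2 ≤ A + (B + B)
    transversal-packing-bound {k} packing = injective⇒≤-covered (strandEdge ∘ chosen)
      (chosen-injective ∘ strandEdge-injective)
        (strandEdge ∘ decode) λ t → encode (chosen t) , cong strandEdge (decode-encode (chosen t))
      where
      open TreePacking packing
      decode : Fin (A + (B + B)) → Strand
      decode t = [ inj₁ , inj₂ ∘ Fin.splitAt B ] (Fin.splitAt A t)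
      encode : Strand → Fin (A + (B + B))
      encode (inj₁ i) = Fin.join A (B + B) (inj₁ i)
      encode (inj₂ x) = Fin.join A (B + B) (inj₂ (Fin.join B B x))
      decode-encode : ∀ σ → decode (encode σ) ≡ σ
      decode-encode (inj₁ i) = cong [ inj₁ , inj₂ ∘ Fin.splitAt B ]
        (Fin.splitAt-join A (B + B) (inj₁ i))
      decode-encode (inj₂ x) = trans (cong [ inj₁ , inj₂ ∘ Fin.splitAt B ]
        (Fin.splitAt-join A (B + B) (inj₂ (Fin.join B B x))))
        (cong inj₂ (Fin.splitAt-join B B x))
      two : ∀ i → ∃₂ λ σ ρ → σ ≢ ρ × strandEdge σ ∈ edges (tree i) × strandEdge ρ ∈ edges (tree i)
      two i = two-strands (isTree i) (connects i)
      pick : Fin k → Fin 2 → Strand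
      pick i zero       = proj₁ (two i)
      pick i (suc zero) = proj₁ (proj₂ (two i))
      pick∈ : ∀ i b → strandEdge (pick i b) ∈ edges (tree i)
      pick∈ i zero       = proj₁ (proj₂ (proj₂ (proj₂ (two i))))
      pick∈ i (suc zero) = proj₂ (proj₂ (proj₂ (proj₂ (two i))))
      pick-injectiveʳ : ∀ i {b b′} → pick i b ≡ pick i b′ → b ≡ b′
      pick-injectiveʳ i {zero}     {zero}     eq = refl
      pick-injectiveʳ i {zero}     {suc zero} eq = contradiction eq (proj₁ (proj₂ (proj₂ (two i))))
      pick-injectiveʳ i {suc zero} {zero}     eq = contradiction (sym eq)
        (proj₁ (proj₂ (proj₂ (two i))))
      pick-injectiveʳ i {suc zero} {suc zero} eq = refl
      pick-injective : ∀ {i j b b′} → pick i b ≡ pick j b′ → i ≡ j × b ≡ b′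
      pick-injective {i} {j} {b} {b′} eq with i Fin.≟ j
      ... | yes refl = refl , pick-injectiveʳ i eq
      ... | no i≢j   = contradiction
        (_ , Sub.x∈p∩q⁺ (pick∈ i b , subst (λ σ → strandEdge σ ∈ edges (tree j)) (sym eq)
          (pick∈ j b′))) (disjoint i≢j)
      chosen : Fin (k * 2) → Strand
      chosen t = pick (proj₁ (Fin.remQuot {k} 2 t)) (proj₂ (Fin.remQuot {k} 2 t))
      chosen-injective : ∀ {t t′} → chosen t ≡ chosen t′ → t ≡ t′
      chosen-injective {t} {t′} eq = let i≡ , b≡ = pick-injective eq in
        trans (sym (Fin.combine-remQuot {k} 2 t))
          (trans (cong₂ Fin.combine i≡ b≡) (Fin.combine-remQuot {k} 2 t′))

    λ₃-upper : ∀ .(3≤n : 3 ≤ n) → λ₃ G 3≤n * 2 ≤ A + (B + B)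
    λ₃-upper 3≤n = ℕ.≤-trans (ℕ.*-monoˡ-≤ 2 (Minimum.least (minimumTripleConnectivity G 3≤n)
      (Transversal , ∣Transversal∣≡3 , refl)))
      (transversal-packing-bound (Maximum.attained (maximumTreePacking G Transversal _)))

-- Arithmetic of `s` and `r`

module Arithmetic where
  open +-*-Solver

  -- Apart from the common 12s this is 4⌈r/2⌉ ≤ 3r + 1, with equality at r = 1.
  lower-trees : ∀ s r → r ≤ 3 → 4 * (3 * s + ⌈ r /2⌉) ≤ suc (3 * (4 * s + r))
  lower-trees s r r≤3 = begin
    4 * (3 * s + ⌈ r /2⌉)   ≡⟨ solve 2 (λ s c → con 4 :*
      (con 3 :* s :+ c) := con 12 :* s :+ con 4 :* c) refl s ⌈ r /2⌉ ⟩
    12 * s + 4 * ⌈ r /2⌉    ≤⟨ ℕ.+-monoʳ-≤ (12 * s) (small r r≤3) ⟩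
    12 * s + suc (3 * r)    ≡⟨ solve 2 (λ s r → con 12 :* s :+
      (con 1 :+ con 3 :* r) := con 1 :+ con 3 :* (con 4 :* s :+ r)) refl s r ⟩
    suc (3 * (4 * s + r))   ∎
    where
    open ℕ.≤-Reasoning
    small : ∀ r → r ≤ 3 → 4 * ⌈ r /2⌉ ≤ suc (3 * r)
    small 0 _ = z≤n
    small 1 _ = ℕ.≤-refl
    small 2 _ = ℕ.m≤n+m 4 3
    small 3 _ = ℕ.m≤n+m 8 2
    small (suc (suc (suc (suc _)))) (s≤s (s≤s (s≤s ())))

  -- Apart from the common 12s this is 3r ≤ 4⌈r/2⌉ + 2, with equality at r = 2: the origin of the 2
  -- in the rational bound.
  scaled-bound : ∀ s r → r ≤ 3 → 3 * (4 * s + r) ≤ (3 * s + ⌈ r /2⌉) * 4 + 2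
  scaled-bound s r r≤3 = begin
    3 * (4 * s + r)              ≡⟨ solve 2 (λ s r → con 3 :*
      (con 4 :* s :+ r) := con 12 :* s :+ con 3 :* r) refl s r ⟩
    12 * s + 3 * r               ≤⟨ ℕ.+-monoʳ-≤ (12 * s) (small r r≤3) ⟩
    12 * s + (4 * ⌈ r /2⌉ + 2)   ≡⟨ solve 2 (λ s c → con 12 :* s :+ (con 4 :* c :+ con 2) :=
      (con 3 :* s :+ c) :* con 4 :+ con 2) refl s ⌈ r /2⌉ ⟩
    (3 * s + ⌈ r /2⌉) * 4 + 2    ∎
    where
    open ℕ.≤-Reasoning
    small : ∀ r → r ≤ 3 → 3 * r ≤ 4 * ⌈ r /2⌉ + 2
    small 0 _ = z≤n
    small 1 _ = ℕ.m≤n+m 3 3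
    small 2 _ = ℕ.≤-refl
    small 3 _ = ℕ.m≤n+m 9 1
    small (suc (suc (suc (suc _)))) (s≤s (s≤s (s≤s ())))

  clique-cut : ∀ s r → (2 * s + ⌊ r /2⌋) + (2 * s + ⌈ r /2⌉) ≡ 4 * s + r
  clique-cut s r = trans
    (solve 3 (λ s a b → (con 2 :* s :+ a) :+ (con 2 :* s :+ b) := con 4 :* s :+
      (a :+ b)) refl s ⌊ r /2⌋ ⌈ r /2⌉)
    (cong (4 * s +_) (ℕ.⌊n/2⌋+⌈n/2⌉≡n r))

  -- As ⌊r/2⌋ ≤ 1, the right side exceeds 2(3s + ⌈r/2⌉) by at most one, too little for a further
  -- tree.
  half : ∀ s r {t} → r ≤ 3 → t * 2 ≤ (2 * s + ⌊ r /2⌋) + ((2 * s + ⌈ r /2⌉) + (2 * s + ⌈ r /2⌉)) →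
         t ≤ 3 * s + ⌈ r /2⌉
  half s r {t} r≤3 le = ℕ.≤-pred (ℕ.*-cancelʳ-< 2 t _ (begin-strict
    t * 2                                                                  ≤⟨ le ⟩
    (2 * s + ⌊ r /2⌋) + ((2 * s + ⌈ r /2⌉) + (2 * s + ⌈ r /2⌉))            ≤⟨ ℕ.+-monoˡ-≤ _
      (ℕ.+-monoʳ-≤ (2 * s) (ℕ.⌊n/2⌋-mono r≤3)) ⟩
    (2 * s + 1) + ((2 * s + ⌈ r /2⌉) + (2 * s + ⌈ r /2⌉))                  <⟨ ℕ.≤-refl ⟩
    suc ((2 * s + 1) + ((2 * s + ⌈ r /2⌉) + (2 * s + ⌈ r /2⌉)))            ≡⟨ solve 2
      (λ s c → con 1 :+ ((con 2 :* s :+ con 1) :+ ((con 2 :* s :+ c) :+ (con 2 :* s :+ c))) :=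
      (con 1 :+ (con 3 :* s :+ c)) :* con 2) refl s ⌈ r /2⌉ ⟩
    suc (3 * s + ⌈ r /2⌉) * 2                                              ∎))
    where open ℕ.≤-Reasoning

open Arithmetic
open import Data.Integer using (+_)

-- Unnormalised fractions avoid reduction to lowest terms and leave a cross-multiplication over the
-- integers. The subtraction takes place there because 3m - 2 is negative for m = 0.
/4-≤ : ∀ m k → 3 * m ≤ k * 4 + 2 → (+ 3 ℤ.* + m ℤ.- + 2) ℚ./ 4 ℚ.≤ (+ k) ℚ./ 1
/4-≤ m k le = ℚ.toℚᵘ-cancel-≤ (ℚᵘ.≤-respˡ-≃ (ℚᵘ.≃-sym
  (ℚ.toℚᵘ-fromℚᵘ (mkℚᵘ (+ 3 ℤ.* + m ℤ.- + 2) 3)))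
  (ℚᵘ.≤-respʳ-≃ (ℚᵘ.≃-sym (ℚ.toℚᵘ-fromℚᵘ (mkℚᵘ (+ k) 0))) (*≤* (begin
    (+ 3 ℤ.* + m ℤ.- + 2) ℤ.* + 1   ≡⟨ ℤ.*-identityʳ (+ 3 ℤ.* + m ℤ.- + 2) ⟩
    + 3 ℤ.* + m ℤ.- + 2             ≡⟨ cong (ℤ._- + 2) (ℤ.pos-* 3 m) ⟨
    + (3 * m) ℤ.- + 2               ≤⟨ ℤ.+-monoˡ-≤ (ℤ.- + 2) (ℤ.+≤+ le) ⟩
    + (k * 4 + 2) ℤ.- + 2           ≡⟨ ℤ.+-assoc (+ (k * 4)) (+ 2) (ℤ.- + 2) ⟩
    + (k * 4) ℤ.+ + 0               ≡⟨ ℤ.+-identityʳ (+ (k * 4)) ⟩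
    + (k * 4)                       ≡⟨ ℤ.pos-* k 4 ⟩
    + k ℤ.* + 4                     ∎))))
  where open ℤ.≤-Reasoning

proposition4 : (∀ n (n≥3 : n ≥ 3) (G : Graph n) → Connected G →
    (∀ s r → r ≤ 3 → edgeConnectivity G (<⇒≤ n≥3) ≡ 4 * s + r →
    λ₃ G n≥3 ≥ 3 * s + ⌈ r /2⌉)
    × ((+ λ₃ G n≥3) ℚ./ 1) ℚ.≥ ((+ 3 ℤ.* + edgeConnectivity G (<⇒≤ n≥3) ℤ.- + 2) ℚ./ 4))
    × (∀ s r → r ≤ 3 → 4 * s + r ≥ 1 →
    ∃ λ n → Σ (n ≥ 3) λ n≥3 → Σ (Graph n) λ G →
    Connected G
    × edgeConnectivity G (<⇒≤ n≥3) ≡ 4 * s + r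
    × λ₃ G n≥3 ≡ 3 * s + ⌈ r /2⌉)
proposition4 = (λ n n≥3 G _ → lower n≥3 G , rational n≥3 G) , tight
  where
  lower : ∀ {n} (n≥3 : n ≥ 3) (G : Graph n) s r → r ≤ 3 → edgeConnectivity G (<⇒≤ n≥3) ≡ 4 * s + r →
          λ₃ G n≥3 ≥ 3 * s + ⌈ r /2⌉
  lower n≥3 G s r r≤3 eq = λ₃-lower G n≥3 (3 * s + ⌈ r /2⌉)
    (subst (λ ℓ → 4 * (3 * s + ⌈ r /2⌉) ≤ suc (3 * ℓ)) (sym eq) (lower-trees s r r≤3))

  rational : ∀ {n} (n≥3 : n ≥ 3) (G : Graph n) →
             ((+ λ₃ G n≥3) ℚ./ 1) ℚ.≥ ((+ 3 ℤ.* + edgeConnectivity G (<⇒≤ n≥3) ℤ.- + 2) ℚ./ 4)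
  rational n≥3 G = /4-≤ ℓ (λ₃ G n≥3) (begin
    3 * ℓ                              ≡⟨ cong (3 *_) ℓ≡ ⟩
    3 * (4 * (ℓ / 4) + ℓ % 4)          ≤⟨ scaled-bound (ℓ / 4) (ℓ % 4) r≤3 ⟩
    (3 * (ℓ / 4) + ⌈ ℓ % 4 /2⌉) * 4 + 2  ≤⟨ ℕ.+-monoˡ-≤ 2
      (ℕ.*-monoˡ-≤ 4 (lower n≥3 G (ℓ / 4) (ℓ % 4) r≤3 ℓ≡)) ⟩
    λ₃ G n≥3 * 4 + 2                   ∎)
    where
    open ℕ.≤-Reasoning
    ℓ : ℕ
    ℓ = edgeConnectivity G (<⇒≤ n≥3)
    r≤3 : ℓ % 4 ≤ 3
    r≤3 = ℕ.≤-pred (m%n<n ℓ 4)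
    ℓ≡ : ℓ ≡ 4 * (ℓ / 4) + ℓ % 4
    ℓ≡ = trans (m≡m%n+[m/n]*n ℓ 4) (trans (ℕ.+-comm (ℓ % 4) _)
      (cong (_+ ℓ % 4) (ℕ.*-comm (ℓ / 4) 4)))

  tight : ∀ s r → r ≤ 3 → 4 * s + r ≥ 1 →
          ∃ λ n → Σ (n ≥ 3) λ n≥3 → Σ (Graph n) λ G →
          Connected G × edgeConnectivity G (<⇒≤ n≥3) ≡ 4 * s + r × λ₃ G n≥3 ≡ 3 * s + ⌈ r /2⌉
  tight s r r≤3 ℓ≥1 = n , n≥3 , G , isConnected (subst (1 ≤_) (sym (clique-cut s r)) ℓ≥1) , λ≡
    , ℕ.≤-antisym (half s r r≤3 (λ₃-upper n≥3)) (lower n≥3 G s r r≤3 λ≡)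
    where
    -- The split of 4s + r is as even as `A ≤ B` permits, which minimises the number A + 2B of
    -- strands, to ⌈3(4s + r)/2⌉.
    open ThreeCliques (2 * s + ⌊ r /2⌋) (2 * s + ⌈ r /2⌉) (ℕ.+-monoʳ-≤ (2 * s) (ℕ.⌊n/2⌋≤⌈n/2⌉ r))
    n≥3 : n ≥ 3
    n≥3 = s≤s (s≤s (s≤s z≤n))
    G : Graph n
    G = graphOf Adj?
    open Realised G (graphOf-sound Adj?) (graphOf-complete Adj?)
    λ≡ : edgeConnectivity G (<⇒≤ n≥3) ≡ 4 * s + r
    λ≡ = trans (ℕ.≤-antisym (edgeConnectivity≤ (<⇒≤ n≥3)) (edgeConnectivity≥ (<⇒≤ n≥3)))
      (clique-cut s r)
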